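{- Let $d, n$ be positive integers, let $t\in\mathbb{R}^d$, and let $X\subseteq\mathbb{R}^d$ be a 1-dense set. Then there exist a tuple $(p_0,\ldots,p_n)$ of points of $\mathbb{R}^d$ and a vector $s\in\mathbb{R}^d$ such that $p_0=\underline{0}$, $p_n=t$, $p_i\in X$ for all $1\le i\le n-1$, and $\|(p_{i+1}-p_i)-s\|\le\sqrt{2}$ for all $0\le i\le n-1$.
   Context: $\|\cdot\|$ is the Euclidean norm on $\mathbb{R}^d$, $\underline{0}$ is the origin, and $\operatorname{dist}$ is Euclidean distance. A set $X\subseteq\mathbb{R}^d$ is called 1-dense if $\operatorname{dist}(y,X)<1$ for every $y\in\mathbb{R}^d$ (equivalently, $X$ intersects every open unit ball). -}

module Defs where

open import Algebra.Bundles using (CommutativeRing)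
import Algebra.Properties.CommutativeMonoid.Sum as Sum
import Algebra.Properties.Ring as RingProperties
open import Data.Nat.Base using (ℕ; zero; suc)
open import Data.Fin.Base using (zero; suc)
open import Data.Product.Base using (∃; _×_; _,_; proj₁)
open import Data.Sum.Base using (inj₁; inj₂)
open import Data.Vec.Functional using (Vector; zipWith; replicate; tail)
open import Data.Vec.Functional.Relation.Binary.Pointwise using (Pointwise)
open import Level using (0ℓ) renaming (suc to lsuc)
open import Relation.Binary.Core using (Rel)
open import Relation.Binary.Definitions using (_Respects_)
import Relation.Binary.Construct.NonStrictToStrict as ToStrict
open import Relation.Binary.Structures using (IsTotalOrder)
open import Relation.Nullary.Negation using (¬_)
open import Relation.Unary using (Pred; _∈_)

module Bounds {A : Set} (_≤_ : Rel A 0ℓ) where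

  IsUpperBound : Pred A 0ℓ → Pred A 0ℓ
  IsUpperBound P b = ∀ {x} → P x → x ≤ b

  IsLowerBound : Pred A 0ℓ → Pred A 0ℓ
  IsLowerBound P b = ∀ {x} → P x → b ≤ x

  IsSupremum : Pred A 0ℓ → Pred A 0ℓ
  IsSupremum P s = IsUpperBound P s × (∀ {b} → IsUpperBound P b → s ≤ b)

  IsInfimum : Pred A 0ℓ → Pred A 0ℓ
  IsInfimum P m = IsLowerBound P m × (∀ {b} → IsLowerBound P b → b ≤ m)

-- The real numbers are characterised as a Dedekind-complete ordered field,
-- which classically is unique up to a unique isomorphism. Equality is a setoid
-- equality, so that, assuming excluded middle, Cauchy sequences of rationals
-- form a model.
record CompleteOrderedField : Set (lsuc 0ℓ) where
  infix 4 _≤_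
  field
    commutativeRing : CommutativeRing 0ℓ 0ℓ

  open CommutativeRing commutativeRing public

  field
    0≉1          : ¬ (0# ≈ 1#)
    inverse      : ∀ x → ¬ (x ≈ 0#) → ∃ λ y → x * y ≈ 1#
    _≤_          : Rel Carrier 0ℓ
    isTotalOrder : IsTotalOrder _≈_ _≤_
    +-monoˡ-≤    : ∀ {x y} z → x ≤ y → x + z ≤ y + z
    *-nonNeg     : ∀ {x y} → 0# ≤ x → 0# ≤ y → 0# ≤ x * y

  open Bounds _≤_ public

  field
    complete : (P : Pred Carrier 0ℓ) → ∃ P → ∃ (IsUpperBound P) → ∃ (IsSupremum P)

  open ToStrict _≈_ _≤_ public using (_<_)

module Euclidean (R : CompleteOrderedField) where

  open CompleteOrderedField R hiding (zero)
  open RingProperties ring using (-‿distribˡ-*; -‿distribʳ-*; -‿involutive)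
  open Sum +-commutativeMonoid using (sum)
  private module ≤ = IsTotalOrder isTotalOrder

  ≤-resp : ∀ {x x′ y y′} → x ≈ x′ → y ≈ y′ → x ≤ y → x′ ≤ y′
  ≤-resp p q r = ≤.≤-respʳ-≈ q (≤.≤-respˡ-≈ p r)

  x≤x+y : ∀ x {y} → 0# ≤ y → x ≤ x + y
  x≤x+y x {y} 0≤y = ≤-resp (+-identityˡ x) (+-comm y x) (+-monoˡ-≤ x 0≤y)

  +-nonNeg : ∀ {x y} → 0# ≤ x → 0# ≤ y → 0# ≤ x + y
  +-nonNeg {x} 0≤x 0≤y = ≤.trans 0≤x (x≤x+y x 0≤y)

  x≤y⇒0≤y-x : ∀ {x y} → x ≤ y → 0# ≤ y - x
  x≤y⇒0≤y-x {x} x≤y = ≤-resp (-‿inverseʳ x) refl (+-monoˡ-≤ (- x) x≤y)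

  0≤y-x⇒x≤y : ∀ {x y} → 0# ≤ y - x → x ≤ y
  0≤y-x⇒x≤y {x} {y} p = ≤-resp (+-identityˡ x)
    (trans (+-assoc y (- x) x) (trans (+-congˡ (-‿inverseˡ x)) (+-identityʳ y)))
    (+-monoˡ-≤ x p)

  square-nonNeg : ∀ x → 0# ≤ x * x
  square-nonNeg x with ≤.total 0# x
  ... | inj₁ 0≤x = *-nonNeg 0≤x 0≤x
  ... | inj₂ x≤0 = ≤.≤-respʳ-≈ -x*-x≈x*x (*-nonNeg 0≤-x 0≤-x)
    where
    0≤-x : 0# ≤ - x
    0≤-x = ≤.≤-respʳ-≈ (+-identityˡ (- x)) (x≤y⇒0≤y-x x≤0)
    -x*-x≈x*x : - x * - x ≈ x * x
    -x*-x≈x*x = trans (sym (-‿distribˡ-* x (- x)))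
      (trans (-‿cong (sym (-‿distribʳ-* x x))) (-‿involutive (x * x)))

  0≤1 : 0# ≤ 1#
  0≤1 = ≤.≤-respʳ-≈ (*-identityˡ 1#) (square-nonNeg 1#)

  root-bounded : ∀ {x} → 0# ≤ x → IsUpperBound (λ y → y * y ≤ x) (x + 1#)
  root-bounded {x} 0≤x {y} y²≤x with ≤.total y 1#
  ... | inj₁ y≤1 = ≤.trans y≤1 (≤.≤-respʳ-≈ (+-comm 1# x) (x≤x+y 1# 0≤x))
  ... | inj₂ 1≤y = ≤.trans (0≤y-x⇒x≤y 0≤y²-y) (≤.trans y²≤x (x≤x+y x 0≤1))
    where
    0≤y²-y : 0# ≤ y * y - y
    0≤y²-y = ≤.≤-respʳ-≈
      (trans (distribˡ y y (- 1#)) (+-congˡ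
        (trans (sym (-‿distribʳ-* y 1#)) (-‿cong (*-identityʳ y)))))
      (*-nonNeg (≤.trans 0≤1 1≤y) (x≤y⇒0≤y-x 1≤y))

  √ : ∀ x → 0# ≤ x → Carrier
  √ x 0≤x = proj₁ (complete (λ y → y * y ≤ x)
    (0# , ≤.≤-respˡ-≈ (sym (zeroˡ 0#)) 0≤x)
    (x + 1# , λ {y} → root-bounded 0≤x {y}))

  √2 : Carrier
  √2 = √ (1# + 1#) (+-nonNeg 0≤1 0≤1)

  ℝ^_ : ℕ → Set
  ℝ^ d = Vector Carrier d

  infix 4 _≋_
  _≋_ : ∀ {d} → Rel (ℝ^ d) 0ℓ
  _≋_ = Pointwise _≈_

  0⃗ : ∀ {d} → ℝ^ d
  0⃗ = replicate _ 0#

  infixl 6 _⊝_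
  _⊝_ : ∀ {d} → ℝ^ d → ℝ^ d → ℝ^ d
  _⊝_ = zipWith _-_

  normSquared : ∀ {d} → ℝ^ d → Carrier
  normSquared v = sum (λ i → v i * v i)

  normSquared-nonNeg : ∀ {d} (v : ℝ^ d) → 0# ≤ normSquared v
  normSquared-nonNeg {zero}  v = ≤.refl
  normSquared-nonNeg {suc d} v =
    +-nonNeg (square-nonNeg (v zero)) (normSquared-nonNeg (tail v))

  ‖_‖ : ∀ {d} → ℝ^ d → Carrier
  ‖ v ‖ = √ (normSquared v) (normSquared-nonNeg v)

  record Subset (d : ℕ) : Set (lsuc 0ℓ) where
    field
      pred     : Pred (ℝ^ d) 0ℓ
      respects : pred Respects _≋_

  infix 4 _∈ˢ_
  _∈ˢ_ : ∀ {d} → ℝ^ d → Subset d → Set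
  x ∈ˢ X = x ∈ Subset.pred X

  -- IsDist y X r says that dist(y , X) = r. For empty X no real r qualifies,
  -- in accordance with dist(y , ∅) = ∞.
  IsDist : ∀ {d} → ℝ^ d → Subset d → Pred Carrier 0ℓ
  IsDist y X = IsInfimum (λ r → ∃ λ x → x ∈ˢ X × r ≈ ‖ y ⊝ x ‖)

  OneDense : ∀ {d} → Pred (Subset d) 0ℓ
  OneDense {d} X = (y : ℝ^ d) → ∃ λ r → IsDist y X r × r < 1#

{-# OPTIONS --safe #-}
module Submission where

-- Look for s together with centres y₀ = 0 , y₁ , … , yₙ₋₁. Let bᵢ ∈ X be within 1
-- of yᵢ, and let aᵢ be a point within 1 of yᵢ that can be reached from 0 by i
-- steps √2-close to s, provided there is one, and aᵢ = bᵢ otherwise. These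
-- choices are discontinuous in (s , y), but a Poincaré–Miranda argument for
-- averages over small cubes gives a probability distribution, concentrated near
-- a single (s , y), for which E[aᵢ + s] ≈ E[bᵢ₊₁] and E[aₙ₋₁ + s] ≈ t. For
-- independent samples with equal means the variances add, so that
-- E‖aᵢ + s − bᵢ₊₁‖² is at most 1 + 1. Hence, if all aᵢ are reachable, then some
-- bᵢ₊₁ is reachable, and therefore all aᵢ₊₁ are; finally t is reachable from
-- some aₙ₋₁. Compactness makes the radius 1 of the balls uniformly smaller, which
-- pays for all approximations.

open import Defs
open import Algebra.Bundles using (CommutativeRing)
open import Algebra.Construct.NaturalChoice.Base using (MinOperator)
import Algebra.Construct.NaturalChoice.Min as Min
import Algebra.Properties.Ring as RingProperties
import Algebra.Properties.Semiring.Mult.TCOptimised as Mult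
import Algebra.Properties.Semiring.Sum as SemiringSum
import Algebra.Solver.Ring as RingSolver
import Algebra.Solver.Ring.AlmostCommutativeRing as ACR
open import Axiom.ExcludedMiddle using (ExcludedMiddle)
open import Data.Bool.Base using (Bool; true; false; _∧_; _xor_)
open import Data.Bool.Properties using (xor-identityʳ; xor-same; ∧-zeroʳ)
open import Data.Bool.Solver using (module xor-∧-Solver)
open import Data.Empty using (⊥-elim-irr)
open import Data.Fin.Base using (Fin; zero; suc; toℕ; fromℕ; fromℕ<; inject₁; combine; remQuot)
open import Data.Fin.Properties using (suc-injective; toℕ-injective; toℕ-fromℕ<; toℕ<n; toℕ-fromℕ; toℕ-inject₁; remQuot-combine; combine-remQuot)
open import Data.Integer.Base as ℤ using (ℤ; +_; -[1+_]; +[1+_])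
import Data.Integer.Properties as ℤ
open import Data.List.Base using (List; []; _∷_; map; tabulate; allFin; length)
open import Data.List.Membership.Propositional using () renaming (_∈_ to _∈ᴸ_; _∉_ to _∉ᴸ_)
open import Data.List.Membership.Propositional.Properties using (∈-tabulate⁺; ∈-tabulate⁻; ∈-map⁻)
open import Data.List.Properties using (map-tabulate; length-tabulate)
open import Data.List.Relation.Unary.Any using (here; there)
open import Data.Maybe.Base using (Maybe; just; nothing)
open import Data.Nat.Base as ℕ using (ℕ; zero; suc; NonZero; _∸_)
open import Data.Nat.DivMod using (_mod_; m<n⇒m%n≡m)
import Data.Nat.Properties as ℕ
open import Data.Product.Base using (Σ; ∃; ∃₂; _×_; _,_; proj₁; proj₂; map₂)
open import Data.Sum.Base using (inj₁; inj₂)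
open import Data.Unit.Base using (⊤; tt)
open import Data.Vec.Base using (Vec; []; _∷_; lookup)
open import Data.Vec.Functional using (Vector; head; tail) renaming (_∷_ to _∷ᶠ_)
open import Function.Base using (_∘_; id; const)
open import Level using (0ℓ)
open import Relation.Binary.Bundles using (TotalOrder)
open import Relation.Binary.PropositionalEquality as ≡ using (_≡_; _≢_; cong; cong₂)
open import Relation.Binary.Structures using (IsTotalOrder)
open import Relation.Nullary.Decidable using (Dec; yes; no; decidable-stable)
open import Relation.Nullary.Negation using (¬_; contradiction)

-- The discrete Poincaré–Miranda theorem

-- Reachability of a point need not vary continuously with (s , y), so a zero theorem cannot be
-- applied to the choices themselves. Their averages over cubes, however, are Lipschitz by
-- boundedness alone. The price is that only a distribution is balanced, and a walk read off from it
-- mixes points of several samples. All samples have nearly the same s and the same centres, so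
-- moving a ball or a chain from one sample to another costs an arbitrarily small amount per step.
-- Poincaré-Miranda asks for as many unknowns as equations, each equation changing sign between the
-- two faces of its own unknown. Writing yᵢ = yᵢ₋₁ + s + vᵢ achieves this: aᵢ₋₁ + s - bᵢ differs
-- from -vᵢ by at most 2 in each coordinate, and t - (aₙ₋₁ + s) is governed by s, because s enters
-- yₙ₋₁ with multiplicity n - 1. The discrete theorem is a parity count: the sum over all cells of a
-- cup product of differentials is a boundary sum, of which a single face survives.

⨁ : ∀ {a} {A : Set a} → (A → Bool) → List A → Bool
⨁ f []       = false
⨁ f (x ∷ xs) = f x xor ⨁ f xs

module _ {a} {A : Set a} where

  ⨁-cong : ∀ {f g : A → Bool} → (∀ x → f x ≡ g x) → ∀ xs → ⨁ f xs ≡ ⨁ g xs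
  ⨁-cong f≗g []       = ≡.refl
  ⨁-cong f≗g (x ∷ xs) = cong₂ _xor_ (f≗g x) (⨁-cong f≗g xs)

  ⨁-false : ∀ {f : A → Bool} xs → (∀ {x} → x ∈ᴸ xs → f x ≡ false) → ⨁ f xs ≡ false
  ⨁-false []       f≡false = ≡.refl
  ⨁-false (x ∷ xs) f≡false = cong₂ _xor_ (f≡false (here ≡.refl)) (⨁-false xs (f≡false ∘ there))

  ⨁-xor : ∀ (f g : A → Bool) xs → ⨁ (λ x → f x xor g x) xs ≡ ⨁ f xs xor ⨁ g xs
  ⨁-xor f g []       = ≡.refl
  ⨁-xor f g (x ∷ xs) = ≡.trans (cong ((f x xor g x) xor_) (⨁-xor f g xs))
    (solve 4 (λ a b c d → (a :+ b) :+ (c :+ d) := (a :+ c) :+ (b :+ d)) ≡.refl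
       (f x) (g x) (⨁ f xs) (⨁ g xs))
    where open xor-∧-Solver

  ⨁-∧ : ∀ b (f : A → Bool) xs → ⨁ (λ x → b ∧ f x) xs ≡ b ∧ ⨁ f xs
  ⨁-∧ b f []       = ≡.sym (∧-zeroʳ b)
  ⨁-∧ b f (x ∷ xs) = ≡.trans (cong ((b ∧ f x) xor_) (⨁-∧ b f xs))
    (solve 3 (λ a c d → (a :* c) :+ (a :* d) := a :* (c :+ d)) ≡.refl b (f x) (⨁ f xs))
    where open xor-∧-Solver

  ⨁-true : ∀ (f : A → Bool) xs → ⨁ f xs ≡ true → ∃ λ x → f x ≡ true
  ⨁-true f (x ∷ xs) eq with f x in fx
  ... | true  = x , fx
  ... | false = ⨁-true f xs eq

⨁-map : ∀ {a b} {A : Set a} {B : Set b} (f : B → Bool) (g : A → B) xs →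
        ⨁ f (map g xs) ≡ ⨁ (f ∘ g) xs
⨁-map f g []       = ≡.refl
⨁-map f g (x ∷ xs) = cong (f (g x) xor_) (⨁-map f g xs)

-- Iterated, this runs through the orders in which the directions of a cube can be traversed.
select : ∀ {a} {A : Set a} → List A → List (A × List A)
select []       = []
select (x ∷ xs) = (x , xs) ∷ map (map₂ (x ∷_)) (select xs)

module _ {a} {A : Set a} where

  ⨁² : (A → A → List A → Bool) → List A → Bool
  ⨁² H xs = ⨁ (λ (x , ys) → ⨁ (λ (y , zs) → H x y zs) (select ys)) (select xs)

  ⨁²-cong : ∀ {G H : A → A → List A → Bool} → (∀ x y zs → G x y zs ≡ H x y zs) →
            ∀ xs → ⨁² G xs ≡ ⨁² H xs
  ⨁²-cong G≗H xs = ⨁-cong (λ (x , ys) → ⨁-cong (λ (y , zs) → G≗H x y zs) (select ys)) (select xs)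

  ⨁²-xor : ∀ (G H : A → A → List A → Bool) xs →
           ⨁² (λ x y zs → G x y zs xor H x y zs) xs ≡ ⨁² G xs xor ⨁² H xs
  ⨁²-xor G H xs = ≡.trans (⨁-cong (λ (x , ys) → ⨁-xor _ _ (select ys)) (select xs)) (⨁-xor _ _ (select xs))

  -- The new head is the first of the two removed entries, the second, or neither.
  ⨁²-∷ : ∀ (H : A → A → List A → Bool) x xs →
         ⨁² H (x ∷ xs) ≡ ⨁ (λ (y , ys) → H x y ys) (select xs)
                         xor (⨁ (λ (y , ys) → H y x ys) (select xs)
                         xor ⨁² (λ y z zs → H y z (x ∷ zs)) xs)
  ⨁²-∷ H x xs = cong (⨁ (λ (y , ys) → H x y ys) (select xs) xor_)
    (≡.trans (⨁-map _ (map₂ (x ∷_)) (select xs))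
    (≡.trans (⨁-cong (λ (y , ys) → cong (H y x ys xor_) (⨁-map _ (map₂ (x ∷_)) (select ys))) (select xs))
    (⨁-xor _ _ (select xs))))

  ⨁²-swap : ∀ (H : A → A → List A → Bool) xs → ⨁² H xs ≡ ⨁² (λ x y → H y x) xs
  ⨁²-swap H []       = ≡.refl
  ⨁²-swap H (x ∷ xs) = ≡.trans (⨁²-∷ H x xs)
    (≡.trans (cong (λ b → p xor (q xor b)) (⨁²-swap (λ y z zs → H y z (x ∷ zs)) xs))
    (≡.trans (solve 3 (λ a b c → a :+ (b :+ c) := b :+ (a :+ c)) ≡.refl p q _)
    (≡.sym (⨁²-∷ (λ y z → H z y) x xs))))
    where
    open xor-∧-Solver
    p = ⨁ (λ (y , ys) → H x y ys) (select xs)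
    q = ⨁ (λ (y , ys) → H y x ys) (select xs)

  -- Each unordered pair is counted twice with the same value and cancels mod 2, which is why no
  -- signs are needed.
  ⨁²-symmetric : ∀ (H : A → A → List A → Bool) → (∀ x y zs → H x y zs ≡ H y x zs) →
                 ∀ xs → ⨁² H xs ≡ false
  ⨁²-symmetric H H-sym []       = ≡.refl
  ⨁²-symmetric H H-sym (x ∷ xs) = ≡.trans (⨁²-∷ H x xs)
    (≡.trans (cong₂ (λ b c → p xor (b xor c)) (⨁-cong (λ (y , ys) → H-sym y x ys) (select xs))
                (⨁²-symmetric (λ y z zs → H y z (x ∷ zs)) (λ y z zs → H-sym y z (x ∷ zs)) xs))
    (≡.trans (cong (p xor_) (xor-identityʳ p)) (xor-same p)))
    where
    p = ⨁ (λ (y , ys) → H x y ys) (select xs)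

select-map : ∀ {a b} {A : Set a} {B : Set b} (f : A → B) xs →
             select (map f xs) ≡ map (λ (x , ys) → f x , map f ys) (select xs)
select-map f []       = ≡.refl
select-map f (x ∷ xs) = cong ((f x , map f xs) ∷_)
  (≡.trans (cong (map (map₂ (f x ∷_))) (select-map f xs)) (lemma (select xs)))
  where
  lemma : ∀ ps → map (map₂ (f x ∷_)) (map (λ (y , ys) → f y , map f ys) ps)
               ≡ map (λ (y , ys) → f y , map f ys) (map (map₂ (x ∷_)) ps)
  lemma []       = ≡.refl
  lemma (_ ∷ ps) = cong (_ ∷_) (lemma ps)

infixl 7 _↑_
_↑_ : ∀ {n} → Vec ℕ n → Fin n → Vec ℕ n
(x ∷ z) ↑ zero  = suc x ∷ z
(x ∷ z) ↑ suc k = x ∷ z ↑ k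

↑-comm : ∀ {n} (z : Vec ℕ n) k l → z ↑ k ↑ l ≡ z ↑ l ↑ k
↑-comm (x ∷ z) zero    zero    = ≡.refl
↑-comm (x ∷ z) zero    (suc l) = ≡.refl
↑-comm (x ∷ z) (suc k) zero    = ≡.refl
↑-comm (x ∷ z) (suc k) (suc l) = cong (x ∷_) (↑-comm z k l)

lookup-↑ : ∀ {n} (z : Vec ℕ n) {k l} → k ≢ l → lookup (z ↑ l) k ≡ lookup z k
lookup-↑ (x ∷ z) {zero}  {zero}  k≢l = contradiction ≡.refl k≢l
lookup-↑ (x ∷ z) {zero}  {suc l} k≢l = ≡.refl
lookup-↑ (x ∷ z) {suc k} {zero}  k≢l = ≡.refl
lookup-↑ (x ∷ z) {suc k} {suc l} k≢l = lookup-↑ z (k≢l ∘ cong suc)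

-- Labels live on all of ℕⁿ, so no lattice path can leave their domain; the box enters only through
-- the sums and the face conditions.
Label : ℕ → Set
Label n = Vec ℕ n → Bool

-- The cup product mod 2 of the differentials of the labels, evaluated on the
-- face of the unit cube at z spanned by the directions ks: the parity of the
-- number of monotone lattice paths from z along which the i-th step changes
-- the i-th label.
ω : ∀ {n} → List (Label n) → List (Fin n) → Label n
ω []       ks z = true
ω (ℓ ∷ ℓs) ks z = ⨁ (λ (k , ls) → (ℓ (z ↑ k) xor ℓ z) ∧ ω ℓs ls (z ↑ k)) (select ks)

-- A product of differentials is a cocycle: the two terms for `k` are the opposite facets orthogonal
-- to `k`. By the Leibniz rule the sum splits into `F`, which contains the second difference of `ℓ`
-- and is symmetric in the first two directions, and `G`, which contains the differential of `ω ℓs`.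
ω-closed : ∀ {n} (ℓs : List (Label n)) ks z →
           ⨁ (λ (k , ls) → ω ℓs ls (z ↑ k) xor ω ℓs ls z) (select ks) ≡ false
ω-closed []       ks z = ⨁-false (select ks) (λ _ → ≡.refl)
ω-closed {n} (ℓ ∷ ℓs) ks z =
  ≡.trans (⨁-cong (λ (k , ls) → ≡.sym (⨁-xor _ _ (select ls))) (select ks))
  (≡.trans (⨁²-cong leibniz ks)
  (≡.trans (⨁²-xor F G ks)
  (cong₂ _xor_ (⨁²-symmetric F F-sym ks) ⨁²G≡false)))
  where
  F G : Fin n → Fin n → List (Fin n) → Bool
  F k l ms = ((ℓ (z ↑ k ↑ l) xor ℓ z) xor (ℓ (z ↑ k) xor ℓ (z ↑ l))) ∧ ω ℓs ms (z ↑ k ↑ l)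
  G k l ms = (ℓ (z ↑ l) xor ℓ z) ∧ (ω ℓs ms (z ↑ l ↑ k) xor ω ℓs ms (z ↑ l))

  leibniz : ∀ k l ms →
    ((ℓ (z ↑ k ↑ l) xor ℓ (z ↑ k)) ∧ ω ℓs ms (z ↑ k ↑ l)) xor ((ℓ (z ↑ l) xor ℓ z) ∧ ω ℓs ms (z ↑ l))
    ≡ F k l ms xor G k l ms
  leibniz k l ms rewrite ↑-comm z l k = solve 6
    (λ a b c d e f → (a :+ b) :* e :+ (c :+ d) :* f
                     := ((a :+ d) :+ (b :+ c)) :* e :+ (c :+ d) :* (e :+ f)) ≡.refl
    (ℓ (z ↑ k ↑ l)) (ℓ (z ↑ k)) (ℓ (z ↑ l)) (ℓ z) (ω ℓs ms (z ↑ k ↑ l)) (ω ℓs ms (z ↑ l))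
    where open xor-∧-Solver

  F-sym : ∀ k l ms → F k l ms ≡ F l k ms
  F-sym k l ms rewrite ↑-comm z l k = solve 5
    (λ a b c d e → ((a :+ d) :+ (b :+ c)) :* e := ((a :+ d) :+ (c :+ b)) :* e) ≡.refl
    (ℓ (z ↑ k ↑ l)) (ℓ (z ↑ k)) (ℓ (z ↑ l)) (ℓ z) (ω ℓs ms (z ↑ k ↑ l))
    where open xor-∧-Solver

  -- With `l` outermost, the first factor of `G` does not depend on `k`, and the inner sum is the
  -- induction hypothesis at `z ↑ l`.
  ⨁²G≡false : ⨁² G ks ≡ false
  ⨁²G≡false = ≡.trans (⨁²-swap G ks) (⨁-false (select ks) λ {(l , ls)} _ →
    ≡.trans (⨁-∧ (ℓ (z ↑ l) xor ℓ z) _ (select ls))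
    (≡.trans (cong ((ℓ (z ↑ l) xor ℓ z) ∧_) (ω-closed ℓs ls (z ↑ l))) (∧-zeroʳ _)))

-- Exactness: ω (ℓ ∷ ℓs) is the differential of ℓ ∪ ω ℓs.
ω-exact : ∀ {n} (ℓ : Label n) ℓs ks z → ω (ℓ ∷ ℓs) ks z
        ≡ ⨁ (λ (k , ls) → (ℓ (z ↑ k) ∧ ω ℓs ls (z ↑ k)) xor (ℓ z ∧ ω ℓs ls z)) (select ks)
ω-exact ℓ ℓs ks z =
  ≡.trans (⨁-cong leibniz (select ks))
  (≡.trans (⨁-xor dF _ (select ks))
  (≡.trans (cong (⨁ dF (select ks) xor_)
     (≡.trans (⨁-∧ (ℓ z) _ (select ks)) (≡.trans (cong (ℓ z ∧_) (ω-closed ℓs ks z)) (∧-zeroʳ _))))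
  (xor-identityʳ _)))
  where
  dF : Fin _ × List (Fin _) → Bool
  dF (k , ls) = (ℓ (z ↑ k) ∧ ω ℓs ls (z ↑ k)) xor (ℓ z ∧ ω ℓs ls z)
  open xor-∧-Solver
  leibniz : ∀ ((k , ls) : Fin _ × List (Fin _)) → (ℓ (z ↑ k) xor ℓ z) ∧ ω ℓs ls (z ↑ k)
    ≡ ((ℓ (z ↑ k) ∧ ω ℓs ls (z ↑ k)) xor (ℓ z ∧ ω ℓs ls z)) xor (ℓ z ∧ (ω ℓs ls (z ↑ k) xor ω ℓs ls z))
  leibniz (k , ls) = solve 4
    (λ a b c d → (a :+ b) :* c := ((a :* c) :+ (b :* d)) :+ b :* (c :+ d)) ≡.refl
    (ℓ (z ↑ k)) (ℓ z) (ω ℓs ls (z ↑ k)) (ω ℓs ls z)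

∈-select : ∀ {a} {A : Set a} {x y : A} {ys} xs → (x , ys) ∈ᴸ select xs → y ∈ᴸ ys → y ∈ᴸ xs
∈-select (x ∷ xs) (here ≡.refl) y∈ys = there y∈ys
∈-select (x ∷ xs) (there p)     y∈ys with ∈-map⁻ (map₂ (x ∷_)) p
∈-select (x ∷ xs) (there p) (here ≡.refl)  | _ , q , ≡.refl = here ≡.refl
∈-select (x ∷ xs) (there p) (there y∈ys) | _ , q , ≡.refl = there (∈-select xs q y∈ys)

head-∈-select : ∀ {a} {A : Set a} {x : A} {ys} xs → (x , ys) ∈ᴸ select xs → x ∈ᴸ xs
head-∈-select (x ∷ xs) (here ≡.refl) = here ≡.refl
head-∈-select (x ∷ xs) (there p) with ∈-map⁻ (map₂ (x ∷_)) p
... | _ , q , ≡.refl = there (head-∈-select xs q)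

-- Distinctness of the directions: a facet orthogonal to a removed direction stays in one
-- hyperplane, as `ω-constant` requires.
∉-select-tabulate : ∀ {a} {A : Set a} {n} (f : Fin n → A) → (∀ {i j} → f i ≡ f j → i ≡ j) →
                    ∀ {x ys} → (x , ys) ∈ᴸ select (tabulate f) → x ∉ᴸ ys
∉-select-tabulate {n = suc n} f f-inj (here ≡.refl) x∈ys with ∈-tabulate⁻ x∈ys
... | i , f0≡fi with () ← f-inj f0≡fi
∉-select-tabulate {n = suc n} f f-inj (there p) x∈ys with ∈-map⁻ (map₂ (f zero ∷_)) p
∉-select-tabulate {n = suc n} f f-inj (there p) (here ≡.refl) | _ , q , ≡.refl with ∈-tabulate⁻ (head-∈-select _ q)
... | i , f0≡fi with () ← f-inj f0≡fi
∉-select-tabulate {n = suc n} f f-inj (there p) (there x∈ys) | _ , q , ≡.refl =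
  ∉-select-tabulate (f ∘ suc) (suc-injective ∘ f-inj) q x∈ys

-- No direction in `ks` moves coordinate `k`, so every path stays in a hyperplane on which `ℓ` is
-- constant, and the step that ought to change `ℓ` contributes the factor `false`.
ω-constant : ∀ {n} {ℓ : Label n} (k : Fin n) {c b} → (∀ z → lookup z k ≡ c → ℓ z ≡ b) →
             ∀ {ℓs} → ℓ ∈ᴸ ℓs → ∀ ks → k ∉ᴸ ks → ∀ z → lookup z k ≡ c → ω ℓs ks z ≡ false
ω-constant {ℓ = ℓ} k {c} {b} const ℓ∈ℓs ks k∉ks z zk = go ℓ∈ℓs
  where
  module _ {l ls} (p : (l , ls) ∈ᴸ select ks) where
    ls⊆ks : ∀ {m} → m ∈ᴸ ls → m ∈ᴸ ks
    ls⊆ks = ∈-select ks p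
    l∈ks : l ∈ᴸ ks
    l∈ks = head-∈-select ks p
    z↑lk : lookup (z ↑ l) k ≡ c
    z↑lk = ≡.trans (lookup-↑ z (λ { ≡.refl → k∉ks l∈ks })) zk
  go : ∀ {ℓs} → ℓ ∈ᴸ ℓs → ω ℓs ks z ≡ false
  go {_ ∷ ℓs} (here ≡.refl) = ⨁-false (select ks) λ {(l , ls)} p →
    cong (_∧ ω ℓs ls (z ↑ l)) (≡.trans (cong₂ _xor_ (const (z ↑ l) (z↑lk p)) (const z zk)) (xor-same b))
  go (there {m} ℓ∈) = ⨁-false (select ks) λ {(l , ls)} p →
    ≡.trans (cong ((m (z ↑ l) xor m z) ∧_)
      (ω-constant k const ℓ∈ ls (k∉ks ∘ ls⊆ks p) (z ↑ l) (z↑lk p)))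
    (∧-zeroʳ _)

ω-face : ∀ {n} c (ℓs : List (Label (suc n))) ks z →
         ω ℓs (map suc ks) (c ∷ z) ≡ ω (map (λ ℓ → ℓ ∘ (c ∷_)) ℓs) ks z
ω-face c []       ks z = ≡.refl
ω-face c (ℓ ∷ ℓs) ks z rewrite select-map Fin.suc ks = ≡.trans (⨁-map _ _ (select ks))
  (⨁-cong (λ (k , ls) → cong (_ ∧_) (ω-face c ℓs ls (z ↑ k))) (select ks))

-- Sums over the cells of a box.

⨁< : ℕ → (ℕ → Bool) → Bool
⨁< zero    f = false
⨁< (suc L) f = f L xor ⨁< L f

⨁<-cong : ∀ L {f g} → (∀ i → f i ≡ g i) → ⨁< L f ≡ ⨁< L g
⨁<-cong zero    f≗g = ≡.refl
⨁<-cong (suc L) f≗g = cong₂ _xor_ (f≗g L) (⨁<-cong L f≗g)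

⨁<-xor : ∀ L (f g : ℕ → Bool) → ⨁< L (λ i → f i xor g i) ≡ ⨁< L f xor ⨁< L g
⨁<-xor zero    f g = ≡.refl
⨁<-xor (suc L) f g = ≡.trans (cong ((f L xor g L) xor_) (⨁<-xor L f g))
  (solve 4 (λ a b c d → (a :+ b) :+ (c :+ d) := (a :+ c) :+ (b :+ d)) ≡.refl
     (f L) (g L) (⨁< L f) (⨁< L g))
  where open xor-∧-Solver

⨁<-false : ∀ L → ⨁< L (λ _ → false) ≡ false
⨁<-false zero    = ≡.refl
⨁<-false (suc L) = ⨁<-false L

⨁<-telescope : ∀ L (f : ℕ → Bool) → ⨁< L (λ i → f (suc i) xor f i) ≡ f L xor f 0
⨁<-telescope zero    f = ≡.sym (xor-same (f 0))
⨁<-telescope (suc L) f = ≡.trans (cong ((f (suc L) xor f L) xor_) (⨁<-telescope L f))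
  (solve 3 (λ a b c → (a :+ b) :+ (b :+ c) := a :+ c) ≡.refl (f (suc L)) (f L) (f 0))
  where open xor-∧-Solver

⨁<-true : ∀ L f → ⨁< L f ≡ true → ∃ λ i → f i ≡ true
⨁<-true (suc L) f eq with f L in fL
... | true  = L , fL
... | false = ⨁<-true L f eq

module _ (L : ℕ) where

  box : ∀ n → Label n → Bool
  box zero    F = F []
  box (suc n) F = ⨁< L (λ i → box n (F ∘ (i ∷_)))

  box-cong : ∀ n {F G : Label n} → (∀ z → F z ≡ G z) → box n F ≡ box n G
  box-cong zero    F≗G = F≗G []
  box-cong (suc n) F≗G = ⨁<-cong L (λ i → box-cong n (F≗G ∘ (i ∷_)))

  box-xor : ∀ n (F G : Label n) → box n (λ z → F z xor G z) ≡ box n F xor box n G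
  box-xor zero    F G = ≡.refl
  box-xor (suc n) F G = ≡.trans (⨁<-cong L (λ i → box-xor n _ _)) (⨁<-xor L _ _)

  box-false : ∀ n {F : Label n} → (∀ z → F z ≡ false) → box n F ≡ false
  box-false zero    F≡f = F≡f []
  box-false (suc n) F≡f = ≡.trans (⨁<-cong L (λ i → box-false n (F≡f ∘ (i ∷_)))) (⨁<-false L)

  box-⨁ : ∀ {a} {A : Set a} n (F : A → Label n) xs →
          box n (λ z → ⨁ (λ x → F x z) xs) ≡ ⨁ (λ x → box n (F x)) xs
  box-⨁ n F []       = box-false n (λ _ → ≡.refl)
  box-⨁ n F (x ∷ xs) = ≡.trans (box-xor n _ _) (cong (box n (F x) xor_) (box-⨁ n F xs))

  box-true : ∀ n (F : Label n) → box n F ≡ true → ∃ λ z → F z ≡ true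
  box-true zero    F eq = [] , eq
  box-true (suc n) F eq with ⨁<-true L _ eq
  ... | i , eq′ with box-true n _ eq′
  ... | z , Fz = i ∷ z , Fz

  box-telescope : ∀ n (F : Label (suc n)) →
    box (suc n) (λ z → F (z ↑ zero) xor F z) ≡ box n (F ∘ (L ∷_)) xor box n (F ∘ (0 ∷_))
  box-telescope n F = ≡.trans (⨁<-cong L (λ i → box-xor n (F ∘ (suc i ∷_)) (F ∘ (i ∷_))))
    (⨁<-telescope L (λ i → box n (F ∘ (i ∷_))))

  -- Telescoping along direction `k` leaves only the two faces orthogonal to it.
  box-vanishing : ∀ {n} (k : Fin n) (F : Label n) →
    (∀ z → lookup z k ≡ 0 → F z ≡ false) → (∀ z → lookup z k ≡ L → F z ≡ false) →
    box n (λ z → F (z ↑ k) xor F z) ≡ false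
  box-vanishing {suc n} zero    F F0 FL = ≡.trans (box-telescope n F)
    (cong₂ _xor_ (box-false n (λ z → FL (L ∷ z) ≡.refl)) (box-false n (λ z → F0 (0 ∷ z) ≡.refl)))
  box-vanishing {suc n} (suc k) F F0 FL = ≡.trans
    (⨁<-cong L (λ i → box-vanishing k (F ∘ (i ∷_)) (λ z → F0 (i ∷ z)) (λ z → FL (i ∷ z))))
    (⨁<-false L)

  module _ {n} (ℓ : Fin n → Label n) where
    LowerFace UpperFace : Set
    LowerFace = ∀ k z → lookup z k ≡ 0 → ℓ k z ≡ false
    UpperFace = ∀ k z → lookup z k ≡ L → ℓ k z ≡ true

  -- Discrete Stokes: by `ω-exact` the sum reduces to the boundary of the box, where the integrand
  -- is `ℓ zero` times `ω` of the other labels. On the faces orthogonal to a direction `suc k` the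
  -- label `ℓ (suc k)` is constant, so `ω` vanishes; on the lower face of direction zero the first
  -- factor vanishes. On the upper face that factor is `true`, and what remains is the same sum one
  -- dimension lower.
  box-ω : ∀ n (ℓ : Fin n → Label n) → LowerFace ℓ → UpperFace ℓ →
          box n (ω (tabulate ℓ) (allFin n)) ≡ true
  box-ω zero    ℓ lower upper = ≡.refl
  box-ω (suc n) ℓ lower upper =
    ≡.trans (box-cong (suc n) (ω-exact (ℓ zero) ℓs (allFin (suc n))))
    (≡.trans (box-⨁ (suc n) dF (select (allFin (suc n))))
    (cong₂ _xor_ direction-zero other-directions))
    where
    ℓs = tabulate (ℓ ∘ suc)
    F : List (Fin (suc n)) → Label (suc n)
    F ls z = ℓ zero z ∧ ω ℓs ls z
    dF : Fin (suc n) × List (Fin (suc n)) → Label (suc n)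
    dF (k , ls) z = F ls (z ↑ k) xor F ls z

    face : ∀ z → F (tabulate suc) (L ∷ z) ≡ ω (tabulate (λ k → ℓ (suc k) ∘ (L ∷_))) (allFin n) z
    face z = ≡.trans (cong (_∧ ω ℓs (tabulate suc) (L ∷ z)) (upper zero (L ∷ z) ≡.refl))
      (≡.trans (cong (λ ks → ω ℓs ks (L ∷ z)) (≡.sym (map-tabulate id suc)))
      (≡.trans (ω-face L ℓs (allFin n) z)
      (cong (λ ms → ω ms (allFin n) z) (map-tabulate (ℓ ∘ suc) _))))

    direction-zero : box (suc n) (dF (zero , tabulate suc)) ≡ true
    direction-zero = ≡.trans (box-telescope n (F (tabulate suc))) (cong₂ _xor_
      (≡.trans (box-cong n face)
        (box-ω n (λ k → ℓ (suc k) ∘ (L ∷_)) (λ k z → lower (suc k) (L ∷ z)) (λ k z → upper (suc k) (L ∷ z))))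
      (box-false n (λ z → cong (_∧ ω ℓs (tabulate suc) (0 ∷ z)) (lower zero (0 ∷ z) ≡.refl))))

    other-directions : ⨁ (λ p → box (suc n) (dF p)) (map (map₂ (zero ∷_)) (select (tabulate suc))) ≡ false
    other-directions = ⨁-false (map (map₂ (zero ∷_)) (select (tabulate suc))) vanish
      where
      vanish : ∀ {p} → p ∈ᴸ map (map₂ (zero ∷_)) (select (tabulate suc)) → box (suc n) (dF p) ≡ false
      vanish {zero , ls} p∈ with ∈-map⁻ (map₂ (zero ∷_)) p∈
      ... | _ , _ , ≡.refl = contradiction (here ≡.refl) (∉-select-tabulate id id (there p∈))
      vanish {suc k , ls} p∈ = box-vanishing (suc k) (F ls)
        (λ z zk → ≡.trans (cong (ℓ zero z ∧_) (ω-constant (suc k) (lower (suc k)) ℓ∈ ls k∉ls z zk)) (∧-zeroʳ _))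
        (λ z zk → ≡.trans (cong (ℓ zero z ∧_) (ω-constant (suc k) (upper (suc k)) ℓ∈ ls k∉ls z zk)) (∧-zeroʳ _))
        where
        ℓ∈ = ∈-tabulate⁺ {f = ℓ ∘ suc} k
        k∉ls = ∉-select-tabulate id id (there p∈)

-- The number of steps is only bounded, so all vertices of a path of length `m` from `z` obey one
-- estimate.
data Climb {n} : ℕ → Vec ℕ n → Vec ℕ n → Set where
  done : ∀ {m z} → Climb m z z
  via : ∀ {m z w} k → Climb m (z ↑ k) w → Climb (suc m) z w

BothValues : ∀ {n} → ℕ → Vec ℕ n → Label n → Set
BothValues m z ℓ = ∃₂ λ w w′ → Climb m z w × Climb m z w′ × ℓ w ≡ false × ℓ w′ ≡ true

-- An odd number of paths is not zero: along one of them each label changes at its own step, and the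
-- ends of that step carry both values.
ω-true : ∀ {n} (ℓs : List (Label n)) ks z → ω ℓs ks z ≡ true →
         ∀ {ℓ} → ℓ ∈ᴸ ℓs → BothValues (length ℓs) z ℓ
ω-true (ℓ ∷ ℓs) ks z eq ℓ∈ with ⨁-true _ (select ks) eq
... | (k , ls) , eq′ with ℓ (z ↑ k) in p | ℓ z in q | ω ℓs ls (z ↑ k) in r
ω-true (ℓ ∷ ℓs) ks z eq (here ≡.refl) | (k , ls) , _ | true | false | true = z , z ↑ k , done , via k done , q , p
ω-true (ℓ ∷ ℓs) ks z eq (here ≡.refl) | (k , ls) , _ | false | true | true = z ↑ k , z , via k done , done , p , q
ω-true (ℓ ∷ ℓs) ks z eq (there ℓ∈) | (k , ls) , _ | true | false | true with ω-true ℓs ls (z ↑ k) r ℓ∈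
... | w , w′ , c , c′ , rest = w , w′ , via k c , via k c′ , rest
ω-true (ℓ ∷ ℓs) ks z eq (there ℓ∈) | (k , ls) , _ | false | true | true with ω-true ℓs ls (z ↑ k) r ℓ∈
... | w , w′ , c , c′ , rest = w , w′ , via k c , via k c′ , rest

poincare-miranda : ∀ {n} L (ℓ : Fin n → Label n) → LowerFace L ℓ → UpperFace L ℓ →
                   ∃ λ z → ∀ k → BothValues n z (ℓ k)
poincare-miranda {n} L ℓ lower upper with box-true L n _ (box-ω L n ℓ lower upper)
... | z , eq = z , λ k → ≡.subst (λ m → BothValues m z (ℓ k)) (length-tabulate ℓ)
                           (ω-true (tabulate ℓ) (allFin n) z eq (∈-tabulate⁺ k))

-- Arithmetic and order in a complete ordered field.

module Analysis (em : ExcludedMiddle 0ℓ) (R : CompleteOrderedField) where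

  open CompleteOrderedField R hiding (zero) public
  open Euclidean R public
  open RingProperties ring using (-‿+-comm; -‿distribˡ-*; -‿distribʳ-*; -‿involutive; -0#≈0#)
  open SemiringSum semiring using (sum; sum-cong-≋; ∑-distrib-+; *-distribˡ-sum) public
  module ≤ = IsTotalOrder isTotalOrder

  -- The ring solver must compare coefficients in order to cancel them. Integers can be compared by
  -- computation and are mapped into the field.
  module IntegerCoefficients where
    open Mult semiring renaming (_×_ to _·_)

    ⟦_⟧ℤ : ℤ → Carrier
    ⟦ + n ⟧ℤ      = n · 1#
    ⟦ -[1+ n ] ⟧ℤ = - (suc n · 1#)

    neg-homo : ∀ i → ⟦ ℤ.- i ⟧ℤ ≈ - ⟦ i ⟧ℤ
    neg-homo (+ zero)   = sym -0#≈0#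
    neg-homo +[1+ n ]   = refl
    neg-homo (-[1+ n ]) = sym (-‿involutive _)

    cancel : ∀ x y z → (x + y) - (x + z) ≈ y - z
    cancel x y z = trans (+-cong (+-comm x y) (sym (-‿+-comm x z)))
      (trans (+-assoc y x _) (+-congˡ (trans (sym (+-assoc x _ _))
        (trans (+-congʳ (-‿inverseʳ x)) (+-identityˡ _)))))

    ⊖-homo : ∀ m n → ⟦ m ℤ.⊖ n ⟧ℤ ≈ m · 1# - n · 1#
    ⊖-homo zero    zero    = sym (-‿inverseʳ 0#)
    ⊖-homo zero    (suc n) = sym (+-identityˡ _)
    ⊖-homo (suc m) zero    = sym (trans (+-congˡ -0#≈0#) (+-identityʳ _))
    ⊖-homo (suc m) (suc n) = trans (reflexive (≡.cong ⟦_⟧ℤ (ℤ.[1+m]⊖[1+n]≡m⊖n m n)))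
      (trans (⊖-homo m n) (sym (trans (+-cong (1+× m 1#) (-‿cong (1+× n 1#))) (cancel _ _ _))))

    +-homo : ∀ i j → ⟦ i ℤ.+ j ⟧ℤ ≈ ⟦ i ⟧ℤ + ⟦ j ⟧ℤ
    +-homo (+ m)      (+ n)      = ×-homo-+ 1# m n
    +-homo (+ m)      -[1+ n ]   = ⊖-homo m (suc n)
    +-homo -[1+ m ]   (+ n)      = trans (⊖-homo n (suc m)) (+-comm _ _)
    +-homo -[1+ m ]   -[1+ n ]   = trans (-‿cong (trans (1+× (suc m ℕ.+ n) 1#)
        (trans (+-congˡ (×-homo-+ 1# (suc m) n)) (trans (sym (+-assoc _ _ _))
        (trans (+-congʳ (+-comm _ _)) (trans (+-assoc _ _ _) (+-congˡ (sym (1+× n 1#)))))))))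
      (sym (-‿+-comm _ _))

    *-homo⁺ : ∀ m j → ⟦ + m ℤ.* j ⟧ℤ ≈ ⟦ + m ⟧ℤ * ⟦ j ⟧ℤ
    *-homo⁺ m (+ n)    = trans (reflexive (≡.cong ⟦_⟧ℤ (≡.sym (ℤ.pos-* m n)))) (×1-homo-* m n)
    *-homo⁺ m -[1+ n ] = trans (reflexive (≡.cong ⟦_⟧ℤ (≡.sym (ℤ.neg-distribʳ-* (+ m) (+ suc n)))))
      (trans (neg-homo (+ m ℤ.* + suc n)) (trans (-‿cong (*-homo⁺ m (+ suc n))) (-‿distribʳ-* _ _)))

    *-homo : ∀ i j → ⟦ i ℤ.* j ⟧ℤ ≈ ⟦ i ⟧ℤ * ⟦ j ⟧ℤ
    *-homo (+ m)    j = *-homo⁺ m j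
    *-homo -[1+ m ] j = trans (reflexive (≡.cong ⟦_⟧ℤ (≡.sym (ℤ.neg-distribˡ-* (+ suc m) j))))
      (trans (neg-homo (+ suc m ℤ.* j)) (trans (-‿cong (*-homo⁺ (suc m) j)) (-‿distribˡ-* _ _)))

    almostCommutativeRing : ACR.AlmostCommutativeRing 0ℓ 0ℓ
    almostCommutativeRing = ACR.fromCommutativeRing commutativeRing

    morphism : CommutativeRing.rawRing ℤ.+-*-commutativeRing ACR.-Raw-AlmostCommutative⟶ almostCommutativeRing
    morphism = record
      { ⟦_⟧ = ⟦_⟧ℤ ; +-homo = +-homo ; *-homo = *-homo ; -‿homo = neg-homo ; 0-homo = refl ; 1-homo = refl }

    coeff≟ : ∀ i j → Maybe (⟦ i ⟧ℤ ≈ ⟦ j ⟧ℤ)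
    coeff≟ i j with i ℤ.≟ j
    ... | yes eq = just (reflexive (≡.cong ⟦_⟧ℤ eq))
    ... | no _   = nothing

  open IntegerCoefficients using (almostCommutativeRing; morphism; coeff≟)
  open RingSolver (CommutativeRing.rawRing ℤ.+-*-commutativeRing) almostCommutativeRing morphism coeff≟ public
    using (solve; _:=_; _:+_; _:*_; _:-_; :-_; con; Polynomial)

  :0 :1 :2 : ∀ {n} → Polynomial n
  :0 = con (+ 0)
  :1 = con (+ 1)
  :2 = con (+ 2)

  2# : Carrier
  2# = 1# + 1#

  infixl 6 _⊕_
  _⊕_ : ∀ {x y} → 0# ≤ x → 0# ≤ y → 0# ≤ x + y
  _⊕_ = +-nonNeg

  infixl 7 _⊗_
  _⊗_ : ∀ {x y} → 0# ≤ x → 0# ≤ y → 0# ≤ x * y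
  _⊗_ = *-nonNeg

  gap : ∀ {x y} → x ≤ y → 0# ≤ y - x
  gap = x≤y⇒0≤y-x

  -- The format of nearly all estimates below: a certificate that writes `y - x` as a sum of
  -- products of nonnegative terms, checked as a polynomial identity.
  by-gap : ∀ {x y e} → 0# ≤ e → e ≈ y - x → x ≤ y
  by-gap 0≤e e≈ = 0≤y-x⇒x≤y (≤.≤-respʳ-≈ e≈ 0≤e)

  ≰⇒≥ : ∀ {x y} → ¬ x ≤ y → y ≤ x
  ≰⇒≥ {x} {y} x≰y with ≤.total x y
  ... | inj₁ x≤y = contradiction x≤y x≰y
  ... | inj₂ y≤x = y≤x

  +-mono-≤ : ∀ {x y u v} → x ≤ y → u ≤ v → x + u ≤ y + v
  +-mono-≤ {x} {y} {u} {v} p q = by-gap (gap p ⊕ gap q)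
    (solve 4 (λ x y u v → (y :- x) :+ (v :- u) := (y :+ v) :- (x :+ u)) refl x y u v)

  *-monoˡ-≤ : ∀ {x y z} → 0# ≤ z → x ≤ y → z * x ≤ z * y
  *-monoˡ-≤ {x} {y} {z} 0≤z p = by-gap (0≤z ⊗ gap p)
    (solve 3 (λ x y z → z :* (y :- x) := z :* y :- z :* x) refl x y z)

  infix 4 0<_
  0<_ : Carrier → Set
  0< x = ¬ (x ≤ 0#)

  0<⇒0≤ : ∀ {x} → 0< x → 0# ≤ x
  0<⇒0≤ = ≰⇒≥

  0<-mono : ∀ {x y} → 0< x → x ≤ y → 0< y
  0<-mono 0<x x≤y y≤0 = 0<x (≤.trans x≤y y≤0)

  0<1 : 0< 1#
  0<1 1≤0 = 0≉1 (≤.antisym 0≤1 1≤0)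

  ≰⇒0< : ∀ {x y} → ¬ (y ≤ x) → 0< (y - x)
  ≰⇒0< {x} {y} y≰x y-x≤0 = y≰x (by-gap (gap y-x≤0)
    (solve 2 (λ x y → :0 :- (y :- x) := x :- y) refl x y))

  recip : ∀ {x} → 0< x → ∃ λ y → 0< y × x * y ≈ 1#
  recip {x} 0<x with inverse x (λ x≈0 → 0<x (≤.reflexive x≈0))
  ... | y , xy≈1 = y , 0<y , xy≈1
    where
    0<y : 0< y
    0<y y≤0 = 0<1 (by-gap (0<⇒0≤ 0<x ⊗ gap y≤0)
      (trans (solve 2 (λ x y → x :* (:0 :- y) := :0 :- x :* y) refl x y) (+-congˡ (-‿cong xy≈1))))

  0<-* : ∀ {x y} → 0< x → 0< y → 0< (x * y)
  0<-* {x} {y} 0<x 0<y xy≤0 with recip 0<y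
  ... | y⁻¹ , 0<y⁻¹ , yy⁻¹≈1 = 0<x (by-gap (0<⇒0≤ 0<y⁻¹ ⊗ gap xy≤0)
    (trans (solve 3 (λ x y r → r :* (:0 :- x :* y) := :0 :- x :* (y :* r)) refl x y y⁻¹)
      (+-congˡ (-‿cong (trans (*-congˡ yy⁻¹≈1) (*-identityʳ x))))))

  ι : ℕ → Carrier
  ι zero    = 0#
  ι (suc n) = ι n + 1#

  0≤ι : ∀ n → 0# ≤ ι n
  0≤ι zero    = ≤.refl
  0≤ι (suc n) = 0≤ι n ⊕ 0≤1

  0<ι : ∀ n → 0< (ι (suc n))
  0<ι n = 0<-mono 0<1 (by-gap (0≤ι n) (solve 1 (λ x → x := (x :+ :1) :- :1) refl (ι n)))

  -- If the naturals were bounded, their supremum minus 1 would still be an upper bound.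
  archimedean : ∀ x → ∃ λ n → x ≤ ι n
  archimedean x with em {P = ∃ λ n → x ≤ ι n}
  ... | yes p = p
  ... | no ¬p with complete (λ y → ∃ λ n → y ≈ ι n) (0# , 0 , refl) (x , λ { {y} (n , y≈) → ≰⇒≥ λ x≤y → ¬p (n , ≤.≤-respʳ-≈ y≈ x≤y) })
  ... | σ , bound , least = contradiction (least {σ - 1#} below) σ≰σ-1
    where
    σ≰σ-1 : ¬ (σ ≤ σ - 1#)
    σ≰σ-1 p = 0<1 (by-gap (gap p) (solve 1 (λ s → (s :- :1) :- s := :0 :- :1) refl σ))
    below : IsUpperBound (λ y → ∃ λ n → y ≈ ι n) (σ - 1#)
    below {y} (n , y≈) = by-gap (gap (bound (suc n , refl)))
      (trans (solve 2 (λ s i → s :- (i :+ :1) := (s :- :1) :- i) refl σ (ι n)) (+-congˡ (-‿cong (sym y≈))))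

  -- The witness is σ / (i + 1 + σ), whose denominator exceeds both σ and i.
  small : ∀ {i σ} → 0# ≤ i → 0< σ → ∃ λ ε → 0< ε × ε ≤ 1# × i * ε ≤ σ
  small {i} {σ} 0≤i 0<σ = σ * r , 0<-* 0<σ 0<r , σr≤1 , iσr≤σ
    where
    0<i+1+σ : 0< ((i + 1#) + σ)
    0<i+1+σ = 0<-mono 0<σ (by-gap (0≤i ⊕ 0≤1)
      (solve 2 (λ i s → i :+ :1 := ((i :+ :1) :+ s) :- s) refl i σ))
    r = proj₁ (recip 0<i+1+σ)
    0<r = proj₁ (proj₂ (recip 0<i+1+σ))
    eq = proj₂ (proj₂ (recip 0<i+1+σ))
    0≤r = 0<⇒0≤ 0<r
    0≤σ = 0<⇒0≤ 0<σ
    σr≤1 : σ * r ≤ 1#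
    σr≤1 = by-gap ((0≤i ⊕ 0≤1) ⊗ 0≤r)
      (trans (solve 3 (λ i s r → (i :+ :1) :* r := ((i :+ :1) :+ s) :* r :- s :* r) refl i σ r) (+-congʳ eq))
    iσr≤σ : i * (σ * r) ≤ σ
    iσr≤σ = by-gap ((0≤1 ⊕ 0≤σ) ⊗ (0≤σ ⊗ 0≤r))
      (trans (solve 3 (λ i s r → (:1 :+ s) :* (s :* r) := s :* (((i :+ :1) :+ s) :* r) :- i :* (s :* r)) refl i σ r)
        (+-congʳ (trans (*-congˡ eq) (*-identityʳ σ))))

  minimum : ∀ {x y} → 0< x → 0< y → ∃ λ z → 0< z × z ≤ x × z ≤ y
  minimum {x} {y} 0<x 0<y with ≤.total x y
  ... | inj₁ x≤y = x , 0<x , ≤.refl , x≤y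
  ... | inj₂ y≤x = y , 0<y , y≤x , ≤.refl

  sum-mono-≤ : ∀ {n} {f g : Fin n → Carrier} → (∀ i → f i ≤ g i) → sum f ≤ sum g
  sum-mono-≤ {zero}  f≤g = ≤.refl
  sum-mono-≤ {suc n} f≤g = +-mono-≤ (f≤g zero) (sum-mono-≤ (λ i → f≤g (suc i)))

  sum-const : ∀ n c → sum {n} (λ _ → c) ≈ ι n * c
  sum-const zero    c = sym (zeroˡ c)
  sum-const (suc n) c = trans (+-congˡ (sum-const n c))
    (solve 2 (λ i c → c :+ i :* c := (i :+ :1) :* c) refl (ι n) c)

  -- Compactness

  Near : Carrier → Carrier → Carrier → Set
  Near δ x y = x - y ≤ δ × y - x ≤ δ

  InBox : ∀ {d} → Carrier → ℝ^ d → Set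
  InBox B y = ∀ k → (- B) ≤ y k × y k ≤ B

  AntitoneScale : ∀ {A : Set} → (Carrier → A → Set) → Set
  AntitoneScale D = ∀ {γ δ x} → δ ≤ γ → D γ x → D δ x

  -- Heine-Borel in the form of a Lebesgue number. Let σ be the supremum of the points up to which
  -- one scale serves. A neighbourhood of σ overlaps such an initial segment and extends it to σ +
  -- γ, which would contradict the bound unless B has been passed.
  interval-compact : (D : Carrier → Carrier → Set) → AntitoneScale D →
    (∀ x → ∃ λ γ → 0< γ × (∀ y → Near γ x y → D γ y)) →
    ∀ {B} → 0# ≤ B → ∃ λ γ → 0< γ × (∀ x → (- B) ≤ x → x ≤ B → D γ x)
  interval-compact D antitone local {B} 0≤B = cover (complete P (- B , P-start (local (- B))) (B , λ {x} → proj₁))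
    where
    Good : Carrier → Carrier → Set
    Good γ x = ∀ y → (- B) ≤ y → y ≤ x → D γ y

    Local : Carrier → Set
    Local x = ∃ λ γ → 0< γ × (∀ y → Near γ x y → D γ y)

    P : Carrier → Set
    P x = x ≤ B × ∃ λ γ → 0< γ × Good γ x

    P-start : Local (- B) → P (- B)
    P-start (γ , 0<γ , near) = by-gap (0≤B ⊕ 0≤B) (solve 1 (λ b → b :+ b := b :- (:- b)) refl B)
      , γ , 0<γ , λ y -B≤y y≤-B → near y
          ( by-gap (0<⇒0≤ 0<γ ⊕ gap -B≤y) (solve 3 (λ b g y → g :+ (y :- (:- b)) := g :- ((:- b) :- y)) refl B γ y)
          , by-gap (0<⇒0≤ 0<γ ⊕ gap y≤-B) (solve 3 (λ b g y → g :+ ((:- b) :- y) := g :- (y :- (:- b))) refl B γ y) )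

    close : ∀ {σ γ} → IsSupremum P σ → 0< γ → ∃ λ x → P x × ¬ (x ≤ σ - γ)
    close {σ} {γ} (_ , least) 0<γ = decidable-stable em λ none → 0<γ (by-gap
      (gap (least {σ - γ} λ {x} Px → decidable-stable em λ x≰ → none (x , Px , x≰)))
      (solve 2 (λ s g → (s :- g) :- s := :0 :- g) refl σ γ))

    beyond : ∀ {σ γ x₀ γ₀ δ} → (∀ y → Near γ σ y → D γ y) → Good γ₀ x₀ → ¬ (x₀ ≤ σ - γ) →
             δ ≤ γ → δ ≤ γ₀ → Good δ (σ + γ)
    beyond {σ} {γ} {x₀} near left x₀≰ δ≤γ δ≤γ₀ y -B≤y y≤σ+γ with ≤.total y x₀
    ... | inj₁ y≤x₀ = antitone δ≤γ₀ (left y -B≤y y≤x₀)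
    ... | inj₂ x₀≤y = antitone δ≤γ (near y
      ( by-gap (gap (≤.trans (≰⇒≥ x₀≰) x₀≤y)) (solve 3 (λ s g y → y :- (s :- g) := g :- (s :- y)) refl σ γ y)
      , by-gap (gap y≤σ+γ) (solve 3 (λ s g y → (s :+ g) :- y := g :- (y :- s)) refl σ γ y)))

    end : ∀ {σ γ δ} → IsUpperBound P σ → 0< γ → 0< δ → Good δ (σ + γ) → B ≤ σ + γ
    end {σ} {γ} {δ} bound 0<γ 0<δ good = decidable-stable em λ B≰ → 0<γ (by-gap
      (gap (bound {σ + γ} (≰⇒≥ B≰ , δ , 0<δ , good)))
      (solve 2 (λ s g → s :- (s :+ g) := :0 :- g) refl σ γ))

    cover : ∃ (IsSupremum P) → ∃ λ γ → 0< γ × (∀ x → (- B) ≤ x → x ≤ B → D γ x)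
    cover (σ , isSup@(bound , _)) =
      let γ , 0<γ , near = local σ
          x₀ , (_ , γ₀ , 0<γ₀ , left) , x₀≰ = close {σ} {γ} isSup 0<γ
          δ , 0<δ , δ≤γ , δ≤γ₀ = minimum 0<γ 0<γ₀
          good = beyond near left x₀≰ δ≤γ δ≤γ₀
      in δ , 0<δ , λ x -B≤x x≤B → good x -B≤x (≤.trans x≤B (end {σ} {γ} {δ} bound 0<γ 0<δ good))

  -- The tube lemma: for a fixed first coordinate `a`, the induction hypothesis is applied to the
  -- property of holding for all first coordinates within the scale of `a`. This gives a uniform
  -- slab around `a`, and slabs are then handled by `interval-compact`.
  box-compact : ∀ d (D : Carrier → ℝ^ d → Set) → AntitoneScale D →
    (∀ {γ x y} → x ≋ y → D γ x → D γ y) →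
    (∀ (x : ℝ^ d) → ∃ λ γ → 0< γ × (∀ (y : ℝ^ d) → (∀ k → Near γ (x k) (y k)) → D γ y)) →
    ∀ {B} → 0# ≤ B → ∃ λ γ → 0< γ × (∀ x → InBox B x → D γ x)
  box-compact zero D antitone respects local 0≤B =
    proj₁ (local 0⃗) , proj₁ (proj₂ (local 0⃗)) , λ x _ → proj₂ (proj₂ (local 0⃗)) x (λ ())
  box-compact (suc d) D antitone respects local {B} 0≤B =
    γ , 0<γ , λ x x∈ → respects (λ { zero → refl ; (suc k) → refl })
      (slabs (head x) (proj₁ (x∈ zero)) (proj₂ (x∈ zero)) (tail x) (λ k → x∈ (suc k)))
    where
    slab : ∀ a → ∃ λ γ → 0< γ × (∀ w → InBox B w → ∀ b → Near γ a b → D γ (b ∷ᶠ w))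
    slab a = box-compact d (λ γ w → ∀ b → Near γ a b → D γ (b ∷ᶠ w))
      (λ δ≤γ f b (p , q) → antitone δ≤γ (f b (≤.trans p δ≤γ , ≤.trans q δ≤γ)))
      (λ x≋y f b near → respects (λ { zero → refl ; (suc k) → x≋y k }) (f b near))
      (λ w → let γ , 0<γ , near = local (a ∷ᶠ w) in
         γ , 0<γ , λ w′ near-w b near-b → near (b ∷ᶠ w′) (λ { zero → near-b ; (suc k) → near-w k }))
      0≤B
    result = interval-compact (λ γ a → ∀ w → InBox B w → D γ (a ∷ᶠ w))
      (λ δ≤γ f w w∈ → antitone δ≤γ (f w w∈))
      (λ a → let γ , 0<γ , f = slab a in γ , 0<γ , λ b near w w∈ → f w w∈ b near)
      0≤B
    γ = proj₁ result
    0<γ = proj₁ (proj₂ result)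
    slabs = proj₂ (proj₂ result)

  -- Squared norms

  square-reflects-≤ : ∀ {x c} → 0< c → x * x ≤ c * c → x ≤ c
  square-reflects-≤ {x} {c} 0<c x²≤c² = decidable-stable em λ x≰c →
    0<-* (≰⇒0< x≰c) (0<-mono 0<c (by-gap (≤.trans (0<⇒0≤ 0<c) (≰⇒≥ x≰c))
        (solve 2 (λ x c → x := (x :+ c) :- c) refl x c)))
      (by-gap (gap x²≤c²) (solve 2 (λ x c → c :* c :- x :* x := :0 :- (x :- c) :* (x :+ c)) refl x c))

  sum-nonNeg : ∀ {n} {f : Fin n → Carrier} → (∀ i → 0# ≤ f i) → 0# ≤ sum f
  sum-nonNeg {zero}  0≤f = ≤.refl
  sum-nonNeg {suc n} 0≤f = 0≤f zero ⊕ sum-nonNeg (λ i → 0≤f (suc i))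

  term≤sum : ∀ {n} {f : Fin n → Carrier} → (∀ i → 0# ≤ f i) → ∀ i → f i ≤ sum f
  term≤sum {f = f} 0≤f zero    = x≤x+y (f zero) (sum-nonNeg (λ i → 0≤f (suc i)))
  term≤sum {f = f} 0≤f (suc i) = ≤.trans (term≤sum (λ i → 0≤f (suc i)) i)
    (by-gap (0≤f zero) (solve 2 (λ a b → a := (a :+ b) :- b) refl (f zero) _))

  normSquared-cong : ∀ {d} {u v : ℝ^ d} → u ≋ v → normSquared u ≈ normSquared v
  normSquared-cong u≋v = sum-cong-≋ (λ k → *-cong (u≋v k) (u≋v k))

  normSquared-flip : ∀ {d} (u v : ℝ^ d) → normSquared (u ⊝ v) ≈ normSquared (v ⊝ u)
  normSquared-flip u v = sum-cong-≋ λ k →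
    solve 2 (λ u v → (u :- v) :* (u :- v) := (v :- u) :* (v :- u)) refl (u k) (v k)

  normSquared-self : ∀ {d} (u : ℝ^ d) → normSquared (u ⊝ u) ≈ 0#
  normSquared-self {d} u = trans
    (sum-cong-≋ (λ k → solve 1 (λ u → (u :- u) :* (u :- u) := :0) refl (u k)))
    (trans (sum-const d 0#) (zeroʳ (ι d)))

  0<2 : 0< 2#
  0<2 = 0<-mono 0<1 (x≤x+y 1# 0≤1)

  normSquared-coordinate : ∀ {d} {u : ℝ^ d} {c} → 0< c → normSquared u ≤ c * c → InBox c u
  normSquared-coordinate {u = u} {c} 0<c u²≤4 k =
      by-gap (gap (square-reflects-≤ 0<c (≤.≤-respˡ-≈ (solve 1 (λ x → x :* x := (:- x) :* (:- x)) refl (u k)) uk²≤4)))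
        (solve 2 (λ x c → c :- (:- x) := x :- (:- c)) refl (u k) c)
    , square-reflects-≤ 0<c uk²≤4
    where
    uk²≤4 = ≤.trans (term≤sum (λ i → square-nonNeg (u i)) k) u²≤4

  near-unit : ∀ {d} {u v : ℝ^ d} → normSquared (u ⊝ v) ≤ 1# → ∀ k → Near 1# (u k) (v k)
  near-unit {u = u} {v} u-v≤1 k =
    let lo , hi = normSquared-coordinate {u = u ⊝ v} {1#} 0<1 (≤.≤-respʳ-≈ (sym (*-identityʳ 1#)) u-v≤1) k
    in hi , by-gap (gap lo) (solve 2 (λ u v → (u :- v) :- (:- :1) := :1 :- (v :- u)) refl (u k) (v k))

  5# : Carrier
  5# = 2# * 2# + 1#

  0≤5 : 0# ≤ 5#
  0≤5 = (0<⇒0≤ 0<2 ⊗ 0<⇒0≤ 0<2) ⊕ 0≤1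

  -- With |u k| ≤ 2 and a change e of size at most ε ≤ 1, the square grows by 2 (u k) e + e² ≤ 4ε +
  -- ε² ≤ 5ε.
  normSquared-perturb : ∀ {d} {u v : ℝ^ d} {ε} → 0# ≤ ε → ε ≤ 1# → normSquared u ≤ 2# * 2# →
    (∀ k → Near ε (u k) (v k)) → normSquared v ≤ normSquared u + (ι d * 5#) * ε
  normSquared-perturb {d} {u} {v} {ε} 0≤ε ε≤1 u²≤4 near = ≤.trans
    (sum-mono-≤ coordinate)
    (≤.reflexive (trans (∑-distrib-+ (λ k → u k * u k) (λ _ → 5# * ε))
      (+-congˡ (trans (sum-const d (5# * ε)) (sym (*-assoc _ _ _))))))
    where
    coordinate : ∀ k → v k * v k ≤ u k * u k + 5# * ε
    coordinate k = let
        -2≤u , u≤2 = normSquared-coordinate {u = u} 0<2 u²≤4 k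
        p , q = near k
      in by-gap (gap u≤2 ⊗ gap p ⊕ gap -2≤u ⊗ gap q ⊕ gap q ⊗ gap p ⊕ 0≤ε ⊗ gap ε≤1)
        (solve 3 (λ u v e → (:2 :- u) :* (e :- (u :- v)) :+ (u :- (:- :2)) :* (e :- (v :- u))
                          :+ (e :- (v :- u)) :* (e :- (u :- v)) :+ e :* (:1 :- e)
                          := (u :* u :+ (:2 :* :2 :+ :1) :* e) :- v :* v) refl (u k) (v k) ε)

  √-mono-≤ : ∀ {x y} (0≤x : 0# ≤ x) (0≤y : 0# ≤ y) → x ≤ y → √ x 0≤x ≤ √ y 0≤y
  √-mono-≤ {x} {y} 0≤x 0≤y x≤y = proj₂ (proj₂ (complete (λ z → z * z ≤ x) _ _))
    (λ {z} z²≤x → proj₁ (proj₂ (complete (λ z → z * z ≤ y) _ _)) (≤.trans z²≤x x≤y))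

  norm≤√2 : ∀ {d} (v : ℝ^ d) → normSquared v ≤ 2# → ‖ v ‖ ≤ √2
  norm≤√2 v = √-mono-≤ (normSquared-nonNeg v) (+-nonNeg 0≤1 0≤1)

  1≤√ : ∀ {x} (0≤x : 0# ≤ x) → 1# ≤ x → 1# ≤ √ x 0≤x
  1≤√ {x} 0≤x 1≤x = proj₁ (proj₂ (complete (λ z → z * z ≤ x) _ _)) (≤.≤-respˡ-≈ (sym (*-identityʳ 1#)) 1≤x)

  module _ {d : ℕ} (X : Subset d) (dense : OneDense X) where

    -- Otherwise 1 would be a lower bound of the distances from y, hence at most the infimum.
    dense-point : ∀ y → ∃ λ x → x ∈ˢ X × ¬ (1# ≤ normSquared (y ⊝ x))
    dense-point y = decidable-stable em λ none → let r , (_ , greatest) , r≤1 , r≉1 = dense y in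
      r≉1 (≤.antisym r≤1 (greatest λ { {_} (x , x∈X , eq) → ≤.≤-respʳ-≈ (sym eq)
        (1≤√ (normSquared-nonNeg (y ⊝ x)) (decidable-stable em λ 1≰ → none (x , x∈X , 1≰))) }))

    uniformly-dense : ∀ {B} → 0# ≤ B →
      ∃ λ γ → 0< γ × (∀ y → InBox B y → ∃ λ x → x ∈ˢ X × normSquared (y ⊝ x) ≤ 1# - γ)
    uniformly-dense = box-compact d (λ γ y → ∃ λ x → x ∈ˢ X × normSquared (y ⊝ x) ≤ 1# - γ)
      (λ { {γ} {δ} δ≤γ (x , x∈X , p) → x , x∈X , ≤.trans p
        (by-gap (gap δ≤γ) (solve 2 (λ g h → g :- h := (:1 :- h) :- (:1 :- g)) refl γ δ)) })
      (λ { y≋z (x , x∈X , p) → x , x∈X , ≤.≤-respˡ-≈ (normSquared-cong λ k → +-congʳ (y≋z k)) p })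
      (λ y → let x , x∈X , 1≰ = dense-point y in local y x x∈X 1≰)
      where
      local : ∀ y x → x ∈ˢ X → ¬ (1# ≤ normSquared (y ⊝ x)) → ∃ λ γ → 0< γ ×
        (∀ (z : ℝ^ d) → (∀ k → Near γ (y k) (z k)) → ∃ λ x → x ∈ˢ X × normSquared (z ⊝ x) ≤ 1# - γ)
      -- With K = `ι d * 5#`, a perturbation costs at most Kγ, and the additional γ is the margin
      -- that must survive; hence `small` is applied to K + 1.
      local y x x∈X 1≰ = let γ , 0<γ , γ≤1 , Kγ≤ = small {ι d * 5# + 1#} ((0≤ι d ⊗ 0≤5) ⊕ 0≤1) (≰⇒0< 1≰) in
        γ , 0<γ , λ z near → x , x∈X , ≤.trans
          (normSquared-perturb {u = y ⊝ x} {z ⊝ x} (0<⇒0≤ 0<γ) γ≤1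
            (≤.trans (≰⇒≥ 1≰) (by-gap (0≤1 ⊕ 0≤1 ⊕ 0≤1) (solve 0 (:1 :+ :1 :+ :1 := :2 :* :2 :- :1) refl)))
            (λ k → translate (near k)))
          (by-gap (gap Kγ≤) (solve 3 (λ K g q → (:1 :- q) :- (K :+ :1) :* g := (:1 :- g) :- (q :+ K :* g)) refl
             (ι d * 5#) γ (normSquared (y ⊝ x))))
        where
        translate : ∀ {γ a b c} → Near γ a b → Near γ (a - c) (b - c)
        translate {γ} {a} {b} {c} (p , q) =
            ≤.≤-respˡ-≈ (solve 3 (λ a b c → a :- b := (a :- c) :- (b :- c)) refl a b c) p
          , ≤.≤-respˡ-≈ (solve 3 (λ a b c → b :- a := (b :- c) :- (a :- c)) refl a b c) q

  -- Means

  -- Expectation as a normalised positive linear functional; independence of two samples then means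
  -- iterating `E`.
  record Mean (I : Set) : Set where
    field
      E       : (I → Carrier) → Carrier
      E-mono  : ∀ {f g} → (∀ i → f i ≤ g i) → E f ≤ E g
      E-+     : ∀ f g → E (λ i → f i + g i) ≈ E f + E g
      E-*     : ∀ c f → E (λ i → c * f i) ≈ c * E f
      E-const : ∀ c → E (λ _ → c) ≈ c

    E-cong : ∀ {f g} → (∀ i → f i ≈ g i) → E f ≈ E g
    E-cong f≈g = ≤.antisym (E-mono (≤.reflexive ∘ f≈g)) (E-mono (≤.reflexive ∘ sym ∘ f≈g))

    E-≤ : ∀ {f c} → (∀ i → f i ≤ c) → E f ≤ c
    E-≤ {c = c} f≤c = ≤.≤-respʳ-≈ (E-const c) (E-mono f≤c)

    E-≥ : ∀ {f c} → (∀ i → c ≤ f i) → c ≤ E f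
    E-≥ {c = c} c≤f = ≤.≤-respˡ-≈ (E-const c) (E-mono c≤f)

    E-sub : ∀ f g → E (λ i → f i - g i) ≈ E f - E g
    E-sub f g = trans (E-cong (λ i → solve 2 (λ a b → a :- b := a :+ (:- :1) :* b) refl (f i) (g i)))
      (trans (E-+ f (λ i → (- 1#) * g i)) (trans (+-congˡ (E-* (- 1#) g))
        (solve 2 (λ a b → a :+ (:- :1) :* b := a :- b) refl (E f) (E g))))

    E-near : ∀ {f g δ} → (∀ i → Near δ (f i) (g i)) → Near δ (E f) (E g)
    E-near {f} {g} near = ≤.≤-respˡ-≈ (E-sub f g) (E-≤ (proj₁ ∘ near))
                        , ≤.≤-respˡ-≈ (E-sub g f) (E-≤ (proj₂ ∘ near))

    E-sum : ∀ {n} (f : Fin n → I → Carrier) → E (λ i → sum (λ k → f k i)) ≈ sum (λ k → E (f k))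
    E-sum {zero}  f = E-const 0#
    E-sum {suc n} f = trans (E-+ (f zero) _) (+-congˡ (E-sum (f ∘ suc)))

    E-quadratic : ∀ f p q → E (λ i → (f i * f i + p * f i) + q) ≈ (E (λ i → f i * f i) + p * E f) + q
    E-quadratic f p q = trans (E-+ _ (λ _ → q)) (+-cong (trans (E-+ _ _) (+-congˡ (E-* p f))) (E-const q))

    module _ (a b : I → Carrier) (p q : Carrier) where
      private
        A B : I → Carrier
        A i = a i - p
        B j = b j - q
        EA  = E A
        EB  = E B
        EA² = E (λ i → A i * A i)
        EB² = E (λ j → B j * B j)

      -- This is Var a + Var b + (E b - E a)², with each variance expanded about a base point of its
      -- own: Var a is `EA² - EA * EA`.
      E-spread : E (λ i → E (λ j → (b j - a i) * (b j - a i)))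
               ≈ (EA² + EB²) + ((E b - E a) * (E b - E a) - (EA * EA + EB * EB))
      E-spread = trans (E-cong inner) (trans (E-quadratic A _ _)
        (trans (solve 6 (λ a² x b² y p q →
            (a² :+ (:- :2 :* ((q :- p) :+ y)) :* x) :+ ((b² :+ :2 :* (q :- p) :* y) :+ (q :- p) :* (q :- p))
            := (a² :+ b²) :+ (((y :+ q) :- (x :+ p)) :* ((y :+ q) :- (x :+ p)) :- (x :* x :+ y :* y)))
            refl EA² EA EB² EB p q)
          (+-congˡ (+-congʳ (*-cong Eb-Ea Eb-Ea)))))
        where
        inner : ∀ i → E (λ j → (b j - a i) * (b j - a i))
                    ≈ (A i * A i + (- 2# * ((q - p) + EB)) * A i) + ((EB² + 2# * (q - p) * EB) + (q - p) * (q - p))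
        inner i = trans (E-cong (λ j → solve 4 (λ a b p q → (b :- a) :* (b :- a)
              := ((b :- q) :* (b :- q) :+ (:2 :* ((q :- p) :- (a :- p))) :* (b :- q)) :+ ((q :- p) :- (a :- p)) :* ((q :- p) :- (a :- p)))
              refl (a i) (b j) p q))
          (trans (E-quadratic B _ _)
            (solve 5 (λ x b² y p q →
              (b² :+ (:2 :* ((q :- p) :- x)) :* y) :+ ((q :- p) :- x) :* ((q :- p) :- x)
              := (x :* x :+ (:- :2 :* ((q :- p) :+ y)) :* x) :+ ((b² :+ :2 :* (q :- p) :* y) :+ (q :- p) :* (q :- p)))
              refl (A i) EB² EB p q))
        Eb-Ea : (EB + q) - (EA + p) ≈ E b - E a
        Eb-Ea = trans (+-cong (+-congʳ (trans (E-sub b _) (+-congˡ (-‿cong (E-const q)))))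
                              (-‿cong (+-congʳ (trans (E-sub a _) (+-congˡ (-‿cong (E-const p)))))))
          (solve 4 (λ a b p q → ((b :- q) :+ q) :- ((a :- p) :+ p) := b :- a) refl (E a) (E b) p q)

      -- Independent samples: the variances add, and dropping the squared means only loses.
      E-spread-≤ : ∀ {τ} → Near τ (E a) (E b) →
        E (λ i → E (λ j → (b j - a i) * (b j - a i))) ≤ (EA² + EB²) + τ * τ
      E-spread-≤ {τ} (p≤ , q≤) = ≤.≤-respˡ-≈ (sym E-spread)
        (by-gap (gap p≤ ⊗ gap q≤ ⊕ square-nonNeg EA ⊕ square-nonNeg EB)
          (solve 6 (λ t a b x y c → (t :- (a :- b)) :* (t :- (b :- a)) :+ x :* x :+ y :* y
            := (c :+ t :* t) :- (c :+ ((b :- a) :* (b :- a) :- (x :* x :+ y :* y)))) refl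
            τ (E a) (E b) EA EB (EA² + EB²)))

    -- Some pair does no worse than the mean. The mean is bounded coordinate by coordinate with
    -- `E-spread-≤`, and the second moments about `p` and `q` sum up to at most `ρ` each.
    close-pair : ∀ {d} (α β : I → ℝ^ d) p q {ρ τ θ} →
      (∀ i → normSquared (α i ⊝ p) ≤ ρ) → (∀ j → normSquared (β j ⊝ q) ≤ ρ) →
      (∀ k → Near τ (E (λ i → α i k)) (E (λ j → β j k))) →
      ¬ (θ ≤ (ρ + ρ) + ι d * (τ * τ)) →
      ∃₂ λ i j → normSquared (β j ⊝ α i) ≤ θ
    close-pair {d} α β p q {ρ} {τ} {θ} αρ βρ near θ≰ =
      decidable-stable em λ none → θ≰ (≤.trans (E-≥ λ i → E-≥ λ j → ≰⇒≥ λ ≤θ → none (i , j , ≤θ)) bound)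
      where
      Eα² Eβ² EE : Fin d → Carrier
      Eα² k = E (λ i → (α i k - p k) * (α i k - p k))
      Eβ² k = E (λ j → (β j k - q k) * (β j k - q k))
      EE  k = E (λ i → E (λ j → (β j k - α i k) * (β j k - α i k)))
      coordinates : E (λ i → E (λ j → normSquared (β j ⊝ α i))) ≈ sum EE
      coordinates = trans (E-cong (λ i → E-sum (λ k j → (β j k - α i k) * (β j k - α i k))))
        (E-sum (λ k i → E (λ j → (β j k - α i k) * (β j k - α i k))))
      total : sum (λ k → (Eα² k + Eβ² k) + τ * τ)
        ≈ (E (λ i → normSquared (α i ⊝ p)) + E (λ j → normSquared (β j ⊝ q))) + ι d * (τ * τ)
      total = trans (∑-distrib-+ (λ k → Eα² k + Eβ² k) (λ _ → τ * τ)) (+-cong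
        (trans (∑-distrib-+ Eα² Eβ²) (+-cong
          (sym (E-sum (λ k i → (α i k - p k) * (α i k - p k))))
          (sym (E-sum (λ k j → (β j k - q k) * (β j k - q k))))))
        (sum-const d (τ * τ)))
      bound : E (λ i → E (λ j → normSquared (β j ⊝ α i))) ≤ (ρ + ρ) + ι d * (τ * τ)
      bound = ≤.≤-respˡ-≈ (sym coordinates) (≤.trans
        (sum-mono-≤ λ k → E-spread-≤ (λ i → α i k) (λ j → β j k) (p k) (q k) (near k))
        (≤.≤-respˡ-≈ (sym total) (+-mono-≤ (+-mono-≤ (E-≤ αρ) (E-≤ βρ)) ≤.refl)))

  module _ where
    open Mean

    ⊤-mean : Mean ⊤
    ⊤-mean = record
      { E = λ f → f tt ; E-mono = λ f≤g → f≤g tt ; E-+ = λ _ _ → refl ; E-* = λ _ _ → refl ; E-const = λ _ → refl }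

    _×-mean_ : ∀ {I J} → Mean I → Mean J → Mean (I × J)
    μ ×-mean ν = record
      { E       = λ f → E μ (λ i → E ν (λ j → f (i , j)))
      ; E-mono  = λ f≤g → E-mono μ (λ i → E-mono ν (λ j → f≤g (i , j)))
      ; E-+     = λ f g → trans (E-cong μ (λ i → E-+ ν _ _)) (E-+ μ _ _)
      ; E-*     = λ c f → trans (E-cong μ (λ i → E-* ν c _)) (E-* μ c _)
      ; E-const = λ c → trans (E-cong μ (λ i → E-const ν c)) (E-const μ c)
      }

    uniform-mean : ∀ M {r} → 0# ≤ r → ι M * r ≈ 1# → Mean (Fin M)
    uniform-mean M {r} 0≤r Mr≈1 = record
      { E       = λ f → r * sum f
      ; E-mono  = λ f≤g → *-monoˡ-≤ 0≤r (sum-mono-≤ f≤g)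
      ; E-+     = λ f g → trans (*-congˡ (∑-distrib-+ f g)) (distribˡ r _ _)
      ; E-*     = λ c f → trans (*-congˡ (sym (*-distribˡ-sum c f)))
                    (solve 3 (λ r c s → r :* (c :* s) := c :* (r :* s)) refl r c (sum f))
      ; E-const = λ c → trans (*-congˡ (sum-const M c))
                    (trans (solve 3 (λ r i c → r :* (i :* c) := (i :* r) :* c) refl r (ι M) c)
                      (trans (*-congʳ Mr≈1) (*-identityˡ c)))
      }

    -- Averages over lattice cubes.

    shift : ∀ {M} → Fin M → ℕ → ℕ
    shift zero    z = z
    shift (suc m) z = shift m (suc z)

    -- A window moved by one loses `g z` and gains one value beyond its old end; that value will
    -- only be bounded, so its position stays anonymous.
    shift-telescope : ∀ M (g : ℕ → Carrier) z → ∃ λ y →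
      sum {M} (λ m → g (shift m (suc z))) + g z ≈ sum {M} (λ m → g (shift m z)) + g y
    shift-telescope zero    g z = z , refl
    shift-telescope (suc M) g z = let y , eq = shift-telescope M g (suc z) in y ,
      trans (+-congʳ (trans (+-comm _ _) eq))
        (solve 3 (λ a b c → (a :+ b) :+ c := (c :+ a) :+ b) refl _ (g y) (g z))

    ι≤ι-shift : ∀ {M} (m : Fin M) z → ι z ≤ ι (shift m z)
    ι≤ι-shift zero    z = ≤.refl
    ι≤ι-shift (suc m) z = ≤.trans (x≤x+y (ι z) 0≤1) (ι≤ι-shift m (suc z))

    ι-shift≤ : ∀ {M} (m : Fin M) z → ι (shift m z) ≤ ι z + ι M
    ι-shift≤ {suc M} zero    z = x≤x+y (ι z) (0≤ι (suc M))
    ι-shift≤ {suc M} (suc m) z = ≤.≤-respʳ-≈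
      (solve 2 (λ a b → (a :+ :1) :+ b := a :+ (b :+ :1)) refl (ι z) (ι M)) (ι-shift≤ m (suc z))

    near-trans : ∀ {δ ε x y z} → Near δ x y → Near ε y z → Near (δ + ε) x z
    near-trans {δ} {ε} {x} {y} {z} (p , q) (p′ , q′) =
        ≤.≤-respˡ-≈ (solve 3 (λ x y z → (x :- y) :+ (y :- z) := x :- z) refl x y z) (+-mono-≤ p p′)
      , ≤.≤-respˡ-≈ (solve 3 (λ x y z → (y :- x) :+ (z :- y) := z :- x) refl x y z) (+-mono-≤ q q′)

    module Cube (M : ℕ) {r : Carrier} (0≤r : 0# ≤ r) (Mr≈1 : ι M * r ≈ 1#) where

      Offset : ℕ → Set
      Offset zero    = ⊤
      Offset (suc n) = Fin M × Offset n

      cube-mean : ∀ n → Mean (Offset n)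
      cube-mean zero    = ⊤-mean
      cube-mean (suc n) = uniform-mean M 0≤r Mr≈1 ×-mean cube-mean n

      translate : ∀ {n} → Vec ℕ n → Offset n → Vec ℕ n
      translate []      o       = []
      translate (x ∷ z) (m , o) = shift m x ∷ translate z o

      lookup-translate : ∀ {n} (z : Vec ℕ n) o k → ∃ λ (m : Fin M) → lookup (translate z o) k ≡ shift m (lookup z k)
      lookup-translate (x ∷ z) (m , o) zero    = m , ≡.refl
      lookup-translate (x ∷ z) (m , o) (suc k) = lookup-translate z o k

      average : ∀ {n} → (Vec ℕ n → Carrier) → Vec ℕ n → Carrier
      average {n} F z = E (cube-mean n) (λ o → F (translate z o))

      module _ {B : Carrier} where
        Bounded : ∀ {n} → (Vec ℕ n → Carrier) → Set
        Bounded F = ∀ z → (- B) ≤ F z × F z ≤ B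

        -- Two neighbouring cubes differ by one slice entering and one leaving. Each has mean at
        -- most `B` in size and weight `r` = 1/M, whatever `F` does in between.
        average-step : ∀ {n} (F : Vec ℕ n → Carrier) → Bounded F →
                       ∀ z k → Near (r * (B + B)) (average F (z ↑ k)) (average F z)
        average-step {suc n} F bounded (x ∷ z) zero = from-telescope (shift-telescope M g x)
          where
          g : ℕ → Carrier
          g y = average (F ∘ (y ∷_)) z
          -B≤g : ∀ y → (- B) ≤ g y
          -B≤g y = E-≥ (cube-mean n) (λ o → proj₁ (bounded (y ∷ translate z o)))
          g≤B : ∀ y → g y ≤ B
          g≤B y = E-≤ (cube-mean n) (λ o → proj₂ (bounded (y ∷ translate z o)))
          telescoped : ∀ {s s′ a b} → s + a ≈ s′ + b → (- B) ≤ a → a ≤ B → (- B) ≤ b → b ≤ B →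
                       Near (r * (B + B)) (r * s) (r * s′)
          telescoped {s} {s′} {a} {b} eq -B≤a a≤B -B≤b b≤B =
              by-gap (0≤r ⊗ (gap -B≤a ⊕ gap b≤B))
                (trans (solve 5 (λ r B a b s → r :* ((a :- (:- B)) :+ (B :- b)) := r :* (B :+ B) :- (r :* ((b :- a) :+ s) :- r :* s)) refl r B a b s′)
                  (+-congˡ (-‿cong (+-congʳ (*-congˡ s≈)))))
            , by-gap (0≤r ⊗ (gap -B≤b ⊕ gap a≤B))
                (trans (solve 5 (λ r B a b s → r :* ((b :- (:- B)) :+ (B :- a)) := r :* (B :+ B) :- (r :* s :- r :* ((b :- a) :+ s))) refl r B a b s′)
                  (+-congˡ (-‿cong (+-congˡ (-‿cong (*-congˡ s≈))))))
            where
            s≈ : (b - a) + s′ ≈ s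
            s≈ = trans (solve 3 (λ a b s → (b :- a) :+ s := (s :+ b) :- a) refl a b s′)
              (trans (+-congʳ (sym eq)) (solve 2 (λ a s → (s :+ a) :- a := s) refl a s))
          from-telescope : (∃ λ y → sum {M} (λ m → g (shift m (suc x))) + g x ≈ sum {M} (λ m → g (shift m x)) + g y) →
                 Near (r * (B + B)) (average F ((x ∷ z) ↑ zero)) (average F (x ∷ z))
          from-telescope (y , eq) = telescoped eq (-B≤g x) (g≤B x) (-B≤g y) (g≤B y)
        average-step {suc n} F bounded (x ∷ z) (suc k) = E-near (uniform-mean M 0≤r Mr≈1)
          (λ m → average-step (F ∘ (shift m x ∷_)) (bounded ∘ (shift m x ∷_)) z k)

        average-climb : ∀ {n} (F : Vec ℕ n → Carrier) → Bounded F → 0# ≤ B →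
                        ∀ {m z w} → Climb m z w → Near (ι m * (r * (B + B))) (average F w) (average F z)
        average-climb F bounded 0≤B {m} {z} done = self , self
          where
          self : average F z - average F z ≤ ι m * (r * (B + B))
          self = ≤.≤-respˡ-≈ (sym (-‿inverseʳ _)) (0≤ι m ⊗ (0≤r ⊗ (0≤B ⊕ 0≤B)))
        average-climb F bounded 0≤B {suc m} {z} (via k climb) =
          let p , q = near-trans (average-climb F bounded 0≤B climb) (average-step F bounded z k)
              eq = solve 2 (λ i c → i :* c :+ c := (i :+ :1) :* c) refl (ι m) (r * (B + B))
          in ≤.≤-respʳ-≈ eq p , ≤.≤-respʳ-≈ eq q

    totalOrder : TotalOrder 0ℓ 0ℓ 0ℓ
    totalOrder = record { isTotalOrder = isTotalOrder }

    open Min totalOrder using (minOperator; x⊓y≤x; x⊓y≤y; ⊓-glb)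
    open MinOperator minOperator using (_⊓_)

    module Position {S h : Carrier} (0≤S : 0# ≤ S) (0≤h : 0# ≤ h) where

      -- The grid -S, -S + h, ... is capped at `S`, because cubes based near the upper face reach
      -- beyond it while `V` is controlled only on the box.
      position : ℕ → Carrier
      position z = S ⊓ (ι z * h - S)

      position-inBox : ∀ z → (- S) ≤ position z × position z ≤ S
      position-inBox z =
          ⊓-glb (by-gap (0≤S ⊕ 0≤S) (solve 1 (λ s → s :+ s := s :- (:- s)) refl S))
                (by-gap (0≤ι z ⊗ 0≤h) (solve 2 (λ x s → x := (x :- s) :- (:- s)) refl (ι z * h) S))
        , x⊓y≤x S _

      module _ {M : ℕ} {ε : Carrier} (Mh≤ε : ι M * h ≤ ε) where

        private
          0≤ε : 0# ≤ ε
          0≤ε = ≤.trans (0≤ι M ⊗ 0≤h) Mh≤ε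

        shifted≥ : ∀ (m : Fin M) z → position z ≤ position (shift m z)
        shifted≥ m z = ⊓-glb (x⊓y≤x S _) (≤.trans (x⊓y≤y S _) (by-gap (gap (ι≤ι-shift m z) ⊗ 0≤h)
          (solve 4 (λ a b h s → (b :- a) :* h := (b :* h :- s) :- (a :* h :- s)) refl (ι z) (ι (shift m z)) h S)))

        shifted≤ : ∀ (m : Fin M) z → position (shift m z) ≤ position z + ε
        shifted≤ m z = by-gap (gap (⊓-glb p-ε≤S p-ε≤y))
          (solve 3 (λ a p e → a :- (p :- e) := (a :+ e) :- p) refl (position z) p ε)
          where
          p = position (shift m z)
          p-ε≤S : p - ε ≤ S
          p-ε≤S = by-gap (gap (x⊓y≤x S (ι (shift m z) * h - S)) ⊕ 0≤ε)
            (solve 3 (λ s p e → (s :- p) :+ e := s :- (p :- e)) refl S p ε)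
          p-ε≤y : p - ε ≤ ι z * h - S
          p-ε≤y = by-gap (gap (x⊓y≤y S (ι (shift m z) * h - S)) ⊕ gap (ι-shift≤ m z) ⊗ 0≤h ⊕ gap Mh≤ε)
            (solve 7 (λ a b m h s p e → ((b :* h :- s) :- p) :+ ((a :+ m) :- b) :* h :+ (e :- m :* h)
                       := (a :* h :- s) :- (p :- e)) refl (ι z) (ι (shift m z)) (ι M) h S p ε)

        shifted-near : ∀ (m m′ : Fin M) z → Near ε (position (shift m z)) (position (shift m′ z))
        shifted-near m m′ z = half m m′ , half m′ m
          where
          half : ∀ m m′ → position (shift m z) - position (shift m′ z) ≤ ε
          half m m′ = by-gap (gap (shifted≤ m z) ⊕ gap (shifted≥ m′ z))
            (solve 4 (λ a b c e → ((a :+ e) :- b) :+ (c :- a) := e :- (b :- c)) refl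
              (position z) (position (shift m z)) (position (shift m′ z)) ε)

        shifted-lower : ∀ (m : Fin M) → position (shift m 0) ≤ ε - S
        shifted-lower m = ≤.trans (shifted≤ m 0) (by-gap (gap (x⊓y≤y S (0# * h - S)))
          (solve 4 (λ p s e h → (:0 :* h :- s) :- p := (e :- s) :- (p :+ e)) refl (position 0) S ε h))

        shifted-upper : ∀ {L} → S + S ≤ ι L * h → ∀ (m : Fin M) → S ≤ position (shift m L)
        shifted-upper {L} 2S≤ m = ≤.trans (⊓-glb ≤.refl (by-gap (gap 2S≤)
          (solve 2 (λ s l → l :- (s :+ s) := (l :- s) :- s) refl S (ι L * h)))) (shifted≥ m L)

    AveragedZero : ∀ {n} → (ℝ^ n → ℝ^ n) → (S ε τ : Carrier) → Set₁
    AveragedZero {n} V S ε τ = Σ Set λ I → Σ (Mean I) λ μ → Σ (I → ℝ^ n) λ p →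
      (∀ i → InBox S (p i)) ×
      (∀ i j k → Near ε (p i k) (p j k)) ×
      (∀ k → Near τ (E μ (λ i → V (p i) k)) 0#)

    -- Averaging over small grid cubes makes V Lipschitz, so that the discrete
    -- Poincaré–Miranda theorem applies although V itself need not be continuous.
    averaged-zero : ∀ {n} (V : ℝ^ n → ℝ^ n) {S B ε τ} → 0# ≤ S → 0# ≤ B → 0< ε → 0< τ →
      (∀ x → InBox S x → InBox B (V x)) →
      (∀ x → InBox S x → ∀ k → x k ≤ ε - S → 0# ≤ V x k) →
      (∀ x → InBox S x → ∀ k → S ≤ x k → V x k ≤ - 1#) →
      AveragedZero V S ε τ
    averaged-zero {n} V {S} {B} {ε} {τ} 0≤S 0≤B 0<ε 0<τ bounded lower upper =
      -- Cubes have `suc M` points per side, so that n lattice steps change an average by at most τ.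
      -- The mesh ε / (M + 1) makes them no wider than ε, and L mesh steps cross the width 2S.
      let τ⁻¹ , 0<τ⁻¹ , ττ⁻¹≈1 = recip 0<τ
          M , K≤M = archimedean (K * τ⁻¹)
          r , 0<r , Mr≈1 = recip (0<ι M)
          h⁻¹ , 0<h⁻¹ , hh⁻¹≈1 = recip (0<-* 0<ε 0<r)
          L , 2S≤L = archimedean ((S + S) * h⁻¹)
      in with-mesh (suc M) (0<⇒0≤ 0<r) Mr≈1 (fine {M = M} ττ⁻¹≈1 K≤M Mr≈1 (0<⇒0≤ 0<r)) L
           (long {L = L} hh⁻¹≈1 2S≤L (0<⇒0≤ (0<-* 0<ε 0<r)))
      where
      K = ι n * (B + B)

      fine : ∀ {τ⁻¹ M r} → τ * τ⁻¹ ≈ 1# → K * τ⁻¹ ≤ ι M → ι (suc M) * r ≈ 1# → 0# ≤ r → r * K ≤ τ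
      fine {τ⁻¹} {M} {r} ττ⁻¹≈1 K≤M Mr≈1 0≤r = by-gap (0<⇒0≤ 0<τ ⊗ 0≤r ⊗ (gap K≤M ⊕ 0≤1))
        (trans (solve 5 (λ t t′ m r k → t :* r :* ((m :- k :* t′) :+ :1)
                           := t :* ((m :+ :1) :* r) :- r :* k :* (t :* t′)) refl τ τ⁻¹ (ι M) r K)
          (+-cong (trans (*-congˡ Mr≈1) (*-identityʳ τ)) (-‿cong (trans (*-congˡ ττ⁻¹≈1) (*-identityʳ _)))))

      long : ∀ {h h⁻¹ L} → h * h⁻¹ ≈ 1# → (S + S) * h⁻¹ ≤ ι L → 0# ≤ h → S + S ≤ ι L * h
      long {h} {h⁻¹} {L} hh⁻¹≈1 2S≤L 0≤h = by-gap (0≤h ⊗ gap 2S≤L)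
        (trans (solve 4 (λ h h′ l s → h :* (l :- s :* h′) := l :* h :- s :* (h :* h′)) refl h h⁻¹ (ι L) (S + S))
          (+-congˡ (-‿cong (trans (*-congˡ hh⁻¹≈1) (*-identityʳ _)))))

      with-mesh : ∀ M {r} → 0# ≤ r → ι M * r ≈ 1# → r * K ≤ τ → ∀ L → S + S ≤ ι L * (ε * r) → AveragedZero V S ε τ
      with-mesh M {r} 0≤r Mr≈1 rK≤τ L 2S≤ = Offset n , cube-mean n , (λ o → x (translate z o))
        , (λ o → x∈ (translate z o)) , near , zero-average
        where
        open Cube M 0≤r Mr≈1
        open Position {S} {ε * r} 0≤S (0<⇒0≤ 0<ε ⊗ 0≤r)

        Mh≤ε : ι M * (ε * r) ≤ ε
        Mh≤ε = ≤.reflexive (trans (solve 3 (λ m e r → m :* (e :* r) := e :* (m :* r)) refl (ι M) ε r)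
          (trans (*-congˡ Mr≈1) (*-identityʳ ε)))

        x : Vec ℕ n → ℝ^ n
        x z k = position (lookup z k)
        x∈ : ∀ z → InBox S (x z)
        x∈ z k = position-inBox (lookup z k)

        A : Fin n → Vec ℕ n → Carrier
        A k = average (λ z → V (x z) k)

        sign : ∀ {P : Set} → Dec P → Bool
        sign (yes _) = false
        sign (no _)  = true
        -- The label is `true` where the average is negative. Hence 0 suffices on the lower side,
        -- whereas the upper side needs a bound strictly below 0.
        ℓ : Fin n → Label n
        ℓ k z = sign (em {P = 0# ≤ A k z})

        ℓ-false : ∀ {k z} → ℓ k z ≡ false → 0# ≤ A k z
        ℓ-false {k} {z} eq with em {P = 0# ≤ A k z}
        ... | yes 0≤A = 0≤A
        ℓ-true : ∀ {k z} → ℓ k z ≡ true → A k z ≤ 0#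
        ℓ-true {k} {z} eq with em {P = 0# ≤ A k z}
        ... | no 0≰A = ≰⇒≥ 0≰A

        -- A cube based on a lower face reaches up to ε into the box, hence the strip in the
        -- hypothesis `lower`. On an upper face the cap puts the whole cube at `S`.
        ℓ-lower : LowerFace L ℓ
        ℓ-lower k z zk≡0 with em {P = 0# ≤ A k z}
        ... | yes _  = ≡.refl
        ... | no 0≰A = contradiction (E-≥ (cube-mean n) (λ o → lower _ (x∈ (translate z o)) k (low o))) 0≰A
          where
          low : ∀ o → x (translate z o) k ≤ ε - S
          low o with lookup-translate z o k
          ... | m , eq rewrite eq | zk≡0 = shifted-lower Mh≤ε m
        ℓ-upper : UpperFace L ℓ
        ℓ-upper k z zk≡L with em {P = 0# ≤ A k z}
        ... | no _    = ≡.refl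
        ... | yes 0≤A = contradiction (by-gap (gap (≤.trans 0≤A
                (E-≤ (cube-mean n) (λ o → upper _ (x∈ (translate z o)) k (high o)))))
                (solve 0 ((:- :1) :- :0 := :0 :- :1) refl)) 0<1
          where
          high : ∀ o → S ≤ x (translate z o) k
          high o with lookup-translate z o k
          ... | m , eq rewrite eq | zk≡L = shifted-upper Mh≤ε 2S≤ m

        miranda : ∃ λ z → ∀ k → BothValues n z (ℓ k)
        miranda = poincare-miranda L ℓ ℓ-lower ℓ-upper
        z = proj₁ miranda

        near : ∀ o o′ k → Near ε (x (translate z o) k) (x (translate z o′) k)
        near o o′ k with lookup-translate z o k | lookup-translate z o′ k
        ... | m , eq | m′ , eq′ rewrite eq | eq′ = shifted-near Mh≤ε m m′ (lookup z k)

        zero-average : ∀ k → Near τ (A k z) 0#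
        zero-average k with proj₂ miranda k
        ... | w , w′ , c , c′ , ℓw , ℓw′ =
            bound (A k z) (A k w′) (proj₂ (climb c′)) (ℓ-true {z = w′} ℓw′)
          , bound′ (A k z) (A k w) (proj₁ (climb c)) (ℓ-false {z = w} ℓw)
          where
          η = ι n * (r * (B + B))
          climb : ∀ {w} → Climb n z w → Near η (A k w) (A k z)
          climb = average-climb (λ z → V (x z) k) (λ z → bounded (x z) (x∈ z) k) 0≤B
          η≤τ : η ≤ τ
          η≤τ = ≤.≤-respˡ-≈ (solve 3 (λ r i b → r :* (i :* b) := i :* (r :* b)) refl r (ι n) (B + B)) rK≤τ
          bound : ∀ a b → a - b ≤ η → b ≤ 0# → a - 0# ≤ τ
          bound a b p q = by-gap (gap p ⊕ gap q ⊕ gap η≤τ)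
            (solve 4 (λ a b h t → (h :- (a :- b)) :+ (:0 :- b) :+ (t :- h) := t :- (a :- :0)) refl a b η τ)
          bound′ : ∀ a b → b - a ≤ η → 0# ≤ b → 0# - a ≤ τ
          bound′ a b p q = by-gap (gap p ⊕ q ⊕ gap η≤τ)
            (solve 4 (λ a b h t → (h :- (b :- a)) :+ b :+ (t :- h) := t :- (:0 :- a)) refl a b η τ)

  -- Walks with nearly equal steps

  near-mono : ∀ {δ ε x y} → δ ≤ ε → Near δ x y → Near ε x y
  near-mono δ≤ε (p , q) = ≤.trans p δ≤ε , ≤.trans q δ≤ε

  near-sym : ∀ {δ x y} → Near δ x y → Near δ y x
  near-sym (p , q) = q , p

  near-+ : ∀ {δ ε a b x y} → Near δ a b → Near ε x y → Near (δ + ε) (a + x) (b + y)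
  near-+ {δ} {ε} {a} {b} {x} {y} (p , q) (p′ , q′) =
      ≤.≤-respˡ-≈ (solve 4 (λ a b x y → (a :- b) :+ (x :- y) := (a :+ x) :- (b :+ y)) refl a b x y) (+-mono-≤ p p′)
    , ≤.≤-respˡ-≈ (solve 4 (λ a b x y → (b :- a) :+ (y :- x) := (b :+ y) :- (a :+ x)) refl a b x y) (+-mono-≤ q q′)

  near-resp : ∀ {δ a b x y} → a - b ≈ x - y → Near δ a b → Near δ x y
  near-resp {δ} {a} {b} {x} {y} eq (p , q) = ≤.≤-respˡ-≈ eq p , ≤.≤-respˡ-≈
    (trans (solve 2 (λ a b → b :- a := :- (a :- b)) refl a b)
      (trans (-‿cong eq) (solve 2 (λ a b → :- (a :- b) := b :- a) refl x y))) q

  ι-mono : ∀ {i j} → i ℕ.≤ j → ι i ≤ ι j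
  ι-mono {j = j} ℕ.z≤n = 0≤ι j
  ι-mono (ℕ.s≤s i≤j) = +-monoˡ-≤ 1# (ι-mono i≤j)

  2≤4 : 2# ≤ 2# * 2#
  2≤4 = by-gap (0≤1 ⊕ 0≤1) (solve 0 (:1 :+ :1 := :2 :* :2 :- :2) refl)

  1≤2 : 1# ≤ 2#
  1≤2 = x≤x+y 1# 0≤1

  module Paths {d : ℕ} (m : ℕ) (X : Subset d) where

    -- Chains 0 = p₀ , … , pᵢ = p with steps close to s; only p₁ , … , pₘ are
    -- required to lie in X.
    Reach : ℕ → Carrier → ℝ^ d → ℝ^ d → Set
    Reach zero    θ s p = p ≋ 0⃗
    Reach (suc i) θ s p = (suc i ℕ.≤ m → p ∈ˢ X) ×
      (∃ λ q → Reach i θ s q × normSquared ((p ⊝ q) ⊝ s) ≤ θ)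

    Reach-map : ∀ {θ θ′ s s′} → (∀ p q → normSquared ((p ⊝ q) ⊝ s) ≤ θ → normSquared ((p ⊝ q) ⊝ s′) ≤ θ′) →
                ∀ i {p} → Reach i θ s p → Reach i θ′ s′ p
    Reach-map f zero    r                 = r
    Reach-map f (suc i) {p} (p∈X , q , r , st) = p∈X , q , Reach-map f i r , f p q st

    module _ {θ : Carrier} {s : ℝ^ d} where

      points : ∀ i {p} → Reach i θ s p → ℕ → ℝ^ d
      points zero    {p} r j = p
      points (suc i) {p} (_ , q , r , _) j with j ℕ.≤? i
      ... | yes _ = points i r j
      ... | no _  = p

      points-last : ∀ i {p} (r : Reach i θ s p) → points i r i ≡ p
      points-last zero    r = ≡.refl
      points-last (suc i) r with suc i ℕ.≤? i
      ... | yes 1+i≤i = contradiction 1+i≤i ℕ.1+n≰n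
      ... | no _      = ≡.refl

      points-first : ∀ i {p} (r : Reach i θ s p) → points i r 0 ≋ 0⃗
      points-first zero    r = r
      points-first (suc i) (_ , q , r , _) with 0 ℕ.≤? i
      ... | yes _  = points-first i r
      ... | no 0≰i = contradiction ℕ.z≤n 0≰i

      points-∈ : ∀ i {p} (r : Reach i θ s p) j → 1 ℕ.≤ j → j ℕ.≤ i → j ℕ.≤ m → points i r j ∈ˢ X
      points-∈ zero    r j 1≤j j≤0 j≤m = contradiction (ℕ.≤-trans 1≤j j≤0) λ ()
      points-∈ (suc i) (p∈X , q , r , _) j 1≤j j≤1+i j≤m with j ℕ.≤? i
      ... | yes j≤i = points-∈ i r j 1≤j j≤i j≤m
      ... | no j≰i  = p∈X (ℕ.≤-trans (ℕ.≰⇒> j≰i) j≤m)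

      points-step : ∀ i {p} (r : Reach i θ s p) j → j ℕ.< i →
                    normSquared ((points i r (suc j) ⊝ points i r j) ⊝ s) ≤ θ
      points-step (suc i) (_ , q , r , st) j j<1+i with suc j ℕ.≤? i | j ℕ.≤? i
      ... | yes j<i | yes _  = points-step i r j j<i
      ... | yes j<i | no j≰i = contradiction (ℕ.<⇒≤ j<i) j≰i
      ... | no j≮i  | no j≰i = contradiction (ℕ.≤-pred j<1+i) j≰i
      ... | no j≮i  | yes j≤i with ℕ.≤-antisym j≤i (ℕ.≮⇒≥ j≮i)
      ...   | ≡.refl rewrite points-last i r = st

  -- The unknowns: a drift and the corrections of the centres.

  module Blocks (d m : ℕ) where
    N = suc m ℕ.* d

    module _ (x : ℝ^ N) where
      -- Block 0 is s and block i is the correction vᵢ for 1 ≤ i ≤ m. Reduction mod `suc m` makes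
      -- every natural number a legal index.
      block : ℕ → ℝ^ d
      block i k = x (combine (i mod suc m) k)

      drift : ℝ^ d
      drift = block 0

      centre : ℕ → ℝ^ d
      centre zero    = 0⃗
      centre (suc i) k = centre i k + (drift k + block (suc i) k)

      block-index : ∀ c → block (toℕ (proj₁ (remQuot {suc m} d c))) (proj₂ (remQuot {suc m} d c)) ≡ x c
      block-index c = ≡.cong x (≡.trans (≡.cong (λ j → combine j (proj₂ (remQuot {suc m} d c))) (mod-toℕ (proj₁ (remQuot {suc m} d c))))
        (combine-remQuot {suc m} d c))
        where
        mod-toℕ : ∀ (j : Fin (suc m)) → toℕ j mod suc m ≡ j
        mod-toℕ j = toℕ-injective (≡.trans (toℕ-fromℕ< _) (m<n⇒m%n≡m (toℕ<n j)))

    module _ {S : Carrier} (x : ℝ^ N) (x∈ : InBox S x) where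

      -- Stated relative to the drift: at drift `S` the lower bound is 0, and at drift `- S` the
      -- upper bound is 0, whatever the corrections are. `Last` relies on this.
      centre-bounds : ∀ i k → ι i * (drift x k - S) ≤ centre x i k × centre x i k ≤ ι i * (drift x k + S)
      centre-bounds zero    k = ≤.reflexive (zeroˡ _) , ≤.reflexive (sym (zeroˡ _))
      centre-bounds (suc i) k =
        let lo , hi = centre-bounds i k
            -S≤v , v≤S = x∈ (combine (suc i mod suc m) k)
            v = block x (suc i) k
        in by-gap (gap lo ⊕ gap -S≤v)
             (solve 5 (λ i s S c v → (c :- i :* (s :- S)) :+ (v :- (:- S)) := (c :+ (s :+ v)) :- (i :+ :1) :* (s :- S))
               refl (ι i) (drift x k) S (centre x i k) v)
         , by-gap (gap hi ⊕ gap v≤S)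
             (solve 5 (λ i s S c v → (i :* (s :+ S) :- c) :+ (S :- v) := (i :+ :1) :* (s :+ S) :- (c :+ (s :+ v)))
               refl (ι i) (drift x k) S (centre x i k) v)

      centre-inBox : 0# ≤ S → ∀ i → i ℕ.≤ m → InBox (ι m * (S + S)) (centre x i)
      centre-inBox 0≤S i i≤m k =
        let lo , hi = centre-bounds i k
            -S≤s , s≤S = x∈ (combine (0 mod suc m) k)
            grow = gap (ι-mono i≤m) ⊗ (0≤S ⊕ 0≤S)
        in by-gap (gap lo ⊕ 0≤ι i ⊗ gap -S≤s ⊕ grow)
             (solve 5 (λ i m s S c → (c :- i :* (s :- S)) :+ i :* (s :- (:- S)) :+ (m :- i) :* (S :+ S) := c :- (:- (m :* (S :+ S))))
               refl (ι i) (ι m) (drift x k) S (centre x i k))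
         , by-gap (gap hi ⊕ 0≤ι i ⊗ gap s≤S ⊕ grow)
             (solve 5 (λ i m s S c → (i :* (s :+ S) :- c) :+ i :* (S :- s) :+ (m :- i) :* (S :+ S) := m :* (S :+ S) :- c)
               refl (ι i) (ι m) (drift x k) S (centre x i k))

    centre-near : ∀ {ε x x′} → (∀ c → Near ε (x c) (x′ c)) → 0# ≤ ε → ∀ i k → Near (ι i * (ε + ε)) (centre x i k) (centre x′ i k)
    centre-near {ε} near 0≤ε zero    k = self , self
      where
      self : 0# - 0# ≤ 0# * (ε + ε)
      self = ≤.reflexive (solve 1 (λ e → :0 :- :0 := :0 :* (e :+ e)) refl ε)
    centre-near {ε} near 0≤ε (suc i) k = near-mono
      (≤.reflexive (solve 2 (λ i e → i :* (e :+ e) :+ (e :+ e) := (i :+ :1) :* (e :+ e)) refl (ι i) ε))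
      (near-+ (centre-near near 0≤ε i k) (near-+ (near _) (near _)))

  -- The balanced ensemble and its error budget.

  module Ensemble {d : ℕ} (m : ℕ) (t : ℝ^ d) (X : Subset d) {T S γ σ ε₁ ε : Carrier}
    (0≤T : 0# ≤ T) (t∈ : InBox T t) (S≡ : S ≈ (T + ι m) + (2# + 1#))
    (pick : ℝ^ d → ℝ^ d)
    (pick-spec : ∀ y → InBox (ι m * (S + S)) y → pick y ∈ˢ X × normSquared (y ⊝ pick y) ≤ 1# - γ)
    (0<σ : 0< σ) (σ-small : (ι m + (5# + 1#)) * σ ≤ γ)
    (0<ε₁ : 0< ε₁) (ε₁≤1 : ε₁ ≤ 1#) (ε₁-small : (ι d * 5#) * ε₁ ≤ σ)
    (0<ε : 0< ε) (ε≤1 : ε ≤ 1#) (ε-small : ((ι m + ι m) + 2#) * ε ≤ ε₁)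
    where

    open Paths m X
    open Blocks d m

    private
      0≤σ = 0<⇒0≤ 0<σ
      0≤ε₁ = 0<⇒0≤ 0<ε₁
      0≤ε = 0<⇒0≤ 0<ε

    0≤S : 0# ≤ S
    0≤S = ≤.≤-respʳ-≈ (sym S≡) ((0≤T ⊕ 0≤ι m) ⊕ ((0≤1 ⊕ 0≤1) ⊕ 0≤1))

    -- Squared radii. `ρ` is the uniform density margin, and each σ pays for one exchange of
    -- samples: `ρ₁` holds about the centre of any sample, `ρ₂` after a second exchange. In `θ₀` one
    -- σ covers the imbalance d ε₁² of the means, and the other makes the inequality for
    -- `close-pair` strict.
    ρ ρ₁ ρ₂ θ₀ : Carrier
    ρ  = 1# - γ
    ρ₁ = ρ + σ
    ρ₂ = ρ₁ + σ
    θ₀ = ((ρ₂ + ρ₂) + σ) + σ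

    -- Each further step carries the chain over to the drift of another sample, at the cost of one
    -- σ. In total `θ m` is 2 - 2γ + (m + 6)σ, whence the 6 in `σ-small`.
    θ : ℕ → Carrier
    θ zero    = θ₀
    θ (suc i) = θ i + σ

    θ≈ : ∀ i → θ i ≈ θ₀ + ι i * σ
    θ≈ zero    = solve 2 (λ a s → a := a :+ :0 :* s) refl θ₀ σ
    θ≈ (suc i) = trans (+-congʳ (θ≈ i))
      (solve 3 (λ a i s → (a :+ i :* s) :+ s := a :+ (i :+ :1) :* s) refl θ₀ (ι i) σ)

    θ₀≤θ : ∀ i → θ₀ ≤ θ i
    θ₀≤θ zero    = ≤.refl
    θ₀≤θ (suc i) = ≤.trans (θ₀≤θ i) (x≤x+y (θ i) 0≤σ)

    0≤γ : 0# ≤ γ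
    0≤γ = ≤.trans ((0≤ι m ⊕ (0≤5 ⊕ 0≤1)) ⊗ 0≤σ) σ-small

    θ≤2 : ∀ i → i ℕ.≤ m → θ i ≤ 2#
    θ≤2 i i≤m = ≤.≤-respˡ-≈ (sym (θ≈ i)) (by-gap (gap σ-small ⊕ gap (ι-mono i≤m) ⊗ 0≤σ ⊕ 0≤γ)
      (solve 4 (λ g s i m → (g :- (m :+ ((:2 :* :2 :+ :1) :+ :1)) :* s) :+ (m :- i) :* s :+ g
        := :2 :- ((((((:1 :- g) :+ s) :+ s) :+ (((:1 :- g) :+ s) :+ s)) :+ s) :+ s :+ i :* s)) refl γ σ (ι i) (ι m)))

    ρ₂≤1 : ρ₂ ≤ 1#
    ρ₂≤1 = by-gap (gap σ-small ⊕ (0≤ι m ⊕ (0<⇒0≤ 0<2 ⊗ 0<⇒0≤ 0<2)) ⊗ 0≤σ)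
      (solve 3 (λ g s m → (g :- (m :+ ((:2 :* :2 :+ :1) :+ :1)) :* s) :+ (m :+ :2 :* :2) :* s
        := :1 :- (((:1 :- g) :+ s) :+ s)) refl γ σ (ι m))

    ρ₁≤1 : ρ₁ ≤ 1#
    ρ₁≤1 = ≤.trans (x≤x+y ρ₁ 0≤σ) ρ₂≤1

    perturb : ∀ {u v : ℝ^ d} {c} → c ≤ 2# → normSquared u ≤ c → (∀ k → Near ε₁ (u k) (v k)) → normSquared v ≤ c + σ
    perturb {u} {v} c≤2 u²≤c near = ≤.trans
      (normSquared-perturb {u = u} {v} 0≤ε₁ ε₁≤1 (≤.trans u²≤c (≤.trans c≤2 2≤4)) near)
      (+-mono-≤ u²≤c ε₁-small)

    -- The radius is `ρ₁` and not `ρ`, so that the point of `X` picked by one sample is also a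
    -- candidate at the centre of any other. One reachable candidate is enough to make the choice
    -- reachable.
    choose : ∀ i s y → ∃ λ a → (normSquared (y ⊝ pick y) ≤ ρ₁ → normSquared (y ⊝ a) ≤ ρ₁) ×
      (∀ p → Reach i (θ i) s p → normSquared (y ⊝ p) ≤ ρ₁ → Reach i (θ i) s a)
    choose i s y with em {P = ∃ λ p → Reach i (θ i) s p × normSquared (y ⊝ p) ≤ ρ₁}
    ... | yes (p , r , y-p) = p , const y-p , λ _ _ _ → r
    ... | no none           = pick y , id , λ p r y-p → contradiction (p , r , y-p) none

    module _ (x : ℝ^ N) where

      a b : ℕ → ℝ^ d
      a i = proj₁ (choose i (drift x) (centre x i))
      b i = pick (centre x i)

      -- Numbered by the controlling block: arrival at `t` belongs to the drift, and the passage
      -- from i to i + 1 belongs to the correction of centre i + 1.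
      defect : ℕ → ℝ^ d
      defect zero    k = t k - (a m k + drift x k)
      defect (suc i) k = (a i k + drift x k) - b (suc i) k

      V : ℝ^ N
      V c = defect (toℕ (proj₁ (remQuot {suc m} d c))) (proj₂ (remQuot {suc m} d c))

    module _ (x : ℝ^ N) (x∈ : InBox S x) where

      b-close : ∀ i → i ℕ.≤ m → b x i ∈ˢ X × normSquared (centre x i ⊝ b x i) ≤ ρ
      b-close i i≤m = pick-spec (centre x i) (centre-inBox x x∈ 0≤S i i≤m)

      a-close : ∀ i → i ℕ.≤ m → normSquared (centre x i ⊝ a x i) ≤ ρ₁
      a-close i i≤m = proj₁ (proj₂ (choose i (drift x) (centre x i)))
        (≤.trans (proj₂ (b-close i i≤m)) (x≤x+y ρ 0≤σ))

      a-near : ∀ i → i ℕ.≤ m → ∀ k → Near 1# (centre x i k) (a x i k)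
      a-near i i≤m = near-unit {u = centre x i} {a x i} (≤.trans (a-close i i≤m) ρ₁≤1)

      b-near : ∀ i → i ℕ.≤ m → ∀ k → Near 1# (centre x i k) (b x i k)
      b-near i i≤m = near-unit {u = centre x i} {b x i}
        (≤.trans (proj₂ (b-close i i≤m)) (≤.trans (x≤x+y ρ 0≤σ) ρ₁≤1))

    3≤S : (2# + 1#) ≤ S
    3≤S = ≤.≤-respʳ-≈ (sym S≡) (by-gap (0≤T ⊕ 0≤ι m)
      (solve 2 (λ t m → t :+ m := ((t :+ m) :+ (:2 :+ :1)) :- (:2 :+ :1)) refl T (ι m)))

    T+m+3≤S : (T + ι m) + (2# + 1#) ≤ S
    T+m+3≤S = ≤.reflexive (sym S≡)

    bound : Carrier
    bound = ((T + S) + ι m * (S + S)) + 2#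

    0≤bound : 0# ≤ bound
    0≤bound = ((0≤T ⊕ 0≤S) ⊕ 0≤ι m ⊗ (0≤S ⊕ 0≤S)) ⊕ (0≤1 ⊕ 0≤1)

    -- `a` and `b` are within 1 of their centres, so the defect is within 2 of `- v`, and 3 ≤ S
    -- fixes its sign at both ends.
    module Inner {a b c s v : Carrier} (a-near : Near 1# c a) (b-near : Near 1# (c + (s + v)) b) where
      private
        D = (a + s) - b
        D≤2-v : D ≤ 2# - v
        D≤2-v = by-gap (gap (proj₂ a-near) ⊕ gap (proj₁ b-near))
          (solve 5 (λ a b c s v → (:1 :- (a :- c)) :+ (:1 :- ((c :+ (s :+ v)) :- b)) := (:2 :- v) :- ((a :+ s) :- b)) refl a b c s v)
        -2-v≤D : - 2# - v ≤ D
        -2-v≤D = by-gap (gap (proj₁ a-near) ⊕ gap (proj₂ b-near))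
          (solve 5 (λ a b c s v → (:1 :- (c :- a)) :+ (:1 :- (b :- (c :+ (s :+ v)))) := ((a :+ s) :- b) :- (:- :2 :- v)) refl a b c s v)

      inner-bounded : (- S) ≤ v → v ≤ S → (- bound) ≤ D × D ≤ bound
      inner-bounded -S≤v v≤S =
          by-gap (gap -2-v≤D ⊕ gap v≤S ⊕ 0≤T ⊕ 0≤ι m ⊗ (0≤S ⊕ 0≤S))
            (solve 5 (λ D v S T m → (D :- (:- :2 :- v)) :+ (S :- v) :+ T :+ m :* (S :+ S)
                       := D :- (:- (((T :+ S) :+ m :* (S :+ S)) :+ :2))) refl D v S T (ι m))
        , by-gap (gap D≤2-v ⊕ gap -S≤v ⊕ 0≤T ⊕ 0≤ι m ⊗ (0≤S ⊕ 0≤S))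
            (solve 5 (λ D v S T m → ((:2 :- v) :- D) :+ (v :- (:- S)) :+ T :+ m :* (S :+ S)
                       := (((T :+ S) :+ m :* (S :+ S)) :+ :2) :- D) refl D v S T (ι m))

      inner-lower : v ≤ ε - S → 0# ≤ D
      inner-lower v≤ = by-gap (gap -2-v≤D ⊕ gap v≤ ⊕ gap 3≤S ⊕ gap ε≤1)
        (solve 4 (λ D v e S → (D :- (:- :2 :- v)) :+ ((e :- S) :- v) :+ (S :- (:2 :+ :1)) :+ (:1 :- e) := D :- :0) refl D v ε S)

      inner-upper : S ≤ v → D ≤ - 1#
      inner-upper S≤v = by-gap (gap D≤2-v ⊕ gap S≤v ⊕ gap 3≤S)
        (solve 3 (λ D v S → ((:2 :- v) :- D) :+ (v :- S) :+ (S :- (:2 :+ :1)) := :- :1 :- D) refl D v S)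

    -- At drift `S` the centre is at least 0, and in the strip above `- S` it is at most mε ≤ m. The
    -- summands T and m in `S` outweigh `t` and this excess.
    module Last {a c s t : Carrier} (a-near : Near 1# c a) (lo : ι m * (s - S) ≤ c) (hi : c ≤ ι m * (s + S))
                (-T≤t : (- T) ≤ t) (t≤T : t ≤ T) where
      private
        D = t - (a + s)

      last-bounded : (- S) ≤ s → s ≤ S → (- bound) ≤ D × D ≤ bound
      last-bounded -S≤s s≤S =
          by-gap (gap -T≤t ⊕ gap (proj₂ a-near) ⊕ gap hi ⊕ 0≤ι m ⊗ gap s≤S ⊕ gap s≤S ⊕ 0≤1)
            (solve 7 (λ a c s t T S m → (t :- (:- T)) :+ (:1 :- (a :- c)) :+ (m :* (s :+ S) :- c) :+ m :* (S :- s) :+ (S :- s) :+ :1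
                       := (t :- (a :+ s)) :- (:- (((T :+ S) :+ m :* (S :+ S)) :+ :2))) refl a c s t T S (ι m))
        , by-gap (gap t≤T ⊕ gap (proj₁ a-near) ⊕ gap lo ⊕ 0≤ι m ⊗ gap -S≤s ⊕ gap -S≤s ⊕ 0≤1)
            (solve 7 (λ a c s t T S m → (T :- t) :+ (:1 :- (c :- a)) :+ (c :- m :* (s :- S)) :+ m :* (s :- (:- S)) :+ (s :- (:- S)) :+ :1
                       := (((T :+ S) :+ m :* (S :+ S)) :+ :2) :- (t :- (a :+ s))) refl a c s t T S (ι m))

      last-lower : s ≤ ε - S → 0# ≤ D
      last-lower s≤ = by-gap (gap -T≤t ⊕ gap (proj₂ a-near) ⊕ gap hi ⊕ 0≤ι m ⊗ gap s≤ ⊕ gap s≤ ⊕ gap T+m+3≤S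
                              ⊕ 0≤ι m ⊗ gap ε≤1 ⊕ gap ε≤1 ⊕ 0≤1)
        (solve 8 (λ a c s t T S m e → (t :- (:- T)) :+ (:1 :- (a :- c)) :+ (m :* (s :+ S) :- c) :+ m :* ((e :- S) :- s) :+ ((e :- S) :- s)
                   :+ (S :- ((T :+ m) :+ (:2 :+ :1))) :+ m :* (:1 :- e) :+ (:1 :- e) :+ :1
                   := (t :- (a :+ s)) :- :0) refl a c s t T S (ι m) ε)

      last-upper : S ≤ s → D ≤ - 1#
      last-upper S≤s = by-gap (gap t≤T ⊕ gap (proj₁ a-near) ⊕ gap lo ⊕ 0≤ι m ⊗ gap S≤s ⊕ gap S≤s ⊕ gap T+m+3≤S ⊕ 0≤ι m ⊕ 0≤1)
        (solve 7 (λ a c s t T S m → (T :- t) :+ (:1 :- (c :- a)) :+ (c :- m :* (s :- S)) :+ m :* (s :- S) :+ (s :- S)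
                   :+ (S :- ((T :+ m) :+ (:2 :+ :1))) :+ m :+ :1
                   := :- :1 :- (t :- (a :+ s))) refl a c s t T S (ι m))

    module _ (x : ℝ^ N) (x∈ : InBox S x) where

      private
        module I (i : ℕ) (i<m : suc i ℕ.≤ m) (k : Fin d) = Inner {a x i k} {b x (suc i) k} {centre x i k} {drift x k} {block x (suc i) k}
          (a-near x x∈ i (ℕ.<⇒≤ i<m) k) (b-near x x∈ (suc i) i<m k)
        module L (k : Fin d) = Last {a x m k} {centre x m k} {drift x k} {t k} (a-near x x∈ m ℕ.≤-refl k)
          (proj₁ (centre-bounds x x∈ m k)) (proj₂ (centre-bounds x x∈ m k)) (proj₁ (t∈ k)) (proj₂ (t∈ k))

      defect-bounded : ∀ i → i ℕ.≤ m → ∀ k → (- bound) ≤ defect x i k × defect x i k ≤ bound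
      defect-bounded zero    _   k = L.last-bounded k (proj₁ (x∈ _)) (proj₂ (x∈ _))
      defect-bounded (suc i) i<m k = I.inner-bounded i i<m k (proj₁ (x∈ _)) (proj₂ (x∈ _))

      defect-lower : ∀ i → i ℕ.≤ m → ∀ k → block x i k ≤ ε - S → 0# ≤ defect x i k
      defect-lower zero    _   k = L.last-lower k
      defect-lower (suc i) i<m k = I.inner-lower i i<m k

      defect-upper : ∀ i → i ℕ.≤ m → ∀ k → S ≤ block x i k → defect x i k ≤ - 1#
      defect-upper zero    _   k = L.last-upper k
      defect-upper (suc i) i<m k = I.inner-upper i i<m k

    index≤m : ∀ (c : Fin N) → toℕ (proj₁ (remQuot {suc m} d c)) ℕ.≤ m
    index≤m c = ℕ.≤-pred (toℕ<n (proj₁ (remQuot {suc m} d c)))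

    zero-defect : AveragedZero V S ε ε₁
    zero-defect = averaged-zero V 0≤S 0≤bound 0<ε 0<ε₁
      (λ x x∈ c → defect-bounded x x∈ _ (index≤m c) _)
      (λ x x∈ c xc≤ → defect-lower x x∈ _ (index≤m c) _ (≤.≤-respˡ-≈ (reflexive (≡.sym (block-index x c))) xc≤))
      (λ x x∈ c S≤xc → defect-upper x x∈ _ (index≤m c) _ (≤.≤-respʳ-≈ (reflexive (≡.sym (block-index x c))) S≤xc))

    -- Assembling a walk from the samples.

    module _ {I : Set} (μ : Mean I) (p : I → ℝ^ N) (p∈ : ∀ i → InBox S (p i))
             (near : ∀ i j c → Near ε (p i c) (p j c))
             (zero-average : ∀ c → Near ε₁ (Mean.E μ (λ i → V (p i) c)) 0#) where

      open Mean μ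

      Eα Eβ : ℕ → Fin d → Carrier
      Eα i k = E (λ j → a (p j) i k + drift (p j) k)
      Eβ i k = E (λ j → b (p j) i k)

      zero-average-defect : ∀ i → i ℕ.≤ m → ∀ k → Near ε₁ (E (λ j → defect (p j) i k)) 0#
      zero-average-defect i i≤m k = ≡.subst (λ i → Near ε₁ (E (λ j → defect (p j) i k)) 0#) (toℕ-fromℕ< (ℕ.s≤s i≤m))
        (≡.subst (λ q → Near ε₁ (E (λ j → defect (p j) (toℕ (proj₁ q)) (proj₂ q))) 0#)
          (remQuot-combine {suc m} (fromℕ< (ℕ.s≤s i≤m)) k)
          (zero-average (combine (fromℕ< (ℕ.s≤s i≤m)) k)))

      balance-inner : ∀ i → suc i ℕ.≤ m → ∀ k → Near ε₁ (Eα i k) (Eβ (suc i) k)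
      balance-inner i i<m k = near-resp
        (trans (+-congʳ (E-sub _ _)) (solve 2 (λ a b → (a :- b) :- :0 := a :- b) refl (Eα i k) (Eβ (suc i) k)))
        (zero-average-defect (suc i) i<m k)

      balance-last : ∀ k → Near ε₁ (Eα m k) (E (λ _ → t k))
      balance-last k = near-sym (near-resp
        (trans (+-congʳ (E-sub _ _)) (solve 2 (λ a b → (b :- a) :- :0 := b :- a) refl (Eα m k) (E (λ _ → t k))))
        (zero-average-defect 0 ℕ.z≤n k))

      ε≤ε₁ : ε ≤ ε₁
      ε≤ε₁ = by-gap (gap ε-small ⊕ ((0≤ι m ⊕ 0≤ι m) ⊕ 0≤1) ⊗ 0≤ε)
        (solve 3 (λ e e₁ m → (e₁ :- ((m :+ m) :+ :2) :* e) :+ ((m :+ m) :+ :1) :* e := e₁ :- e) refl ε ε₁ (ι m))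

      2iε+ε≤ε₁ : ∀ i → i ℕ.≤ m → ι i * (ε + ε) + ε ≤ ε₁
      2iε+ε≤ε₁ i i≤m = by-gap (gap ε-small ⊕ gap (ι-mono i≤m) ⊗ (0≤ε ⊕ 0≤ε) ⊕ 0≤ε)
        (solve 4 (λ e e₁ i m → (e₁ :- ((m :+ m) :+ :2) :* e) :+ (m :- i) :* (e :+ e) :+ e := e₁ :- (i :* (e :+ e) :+ e))
          refl ε ε₁ (ι i) (ι m))

      drift-near : ∀ i j k → Near ε₁ (drift (p i) k) (drift (p j) k)
      drift-near i j k = near-mono ε≤ε₁ (near i j _)

      centre+drift-near : ∀ l → l ℕ.≤ m → ∀ i j k →
        Near ε₁ (centre (p i) l k + drift (p i) k) (centre (p j) l k + drift (p j) k)
      centre+drift-near l l≤m i j k = near-mono (2iε+ε≤ε₁ l l≤m)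
        (near-+ (centre-near (near i j) 0≤ε l k) (near i j _))

      centres-near : ∀ l → l ℕ.≤ m → ∀ i j k → Near ε₁ (centre (p i) l k) (centre (p j) l k)
      centres-near l l≤m i j k = near-mono (≤.trans (x≤x+y _ 0≤ε) (2iε+ε≤ε₁ l l≤m)) (centre-near (near i j) 0≤ε l k)

      -- The second moment in `close-pair` is taken about one point for all samples, so the own
      -- centre of sample `i` is exchanged for that of sample `j`.
      α-close : ∀ l → l ℕ.≤ m → ∀ i j →
        normSquared ((λ k → a (p i) l k + drift (p i) k) ⊝ (λ k → centre (p j) l k + drift (p j) k)) ≤ ρ₂
      α-close l l≤m i j = perturb {u = a (p i) l ⊝ centre (p i) l} (≤.trans ρ₁≤1 1≤2)
        (≤.≤-respˡ-≈ (normSquared-flip (centre (p i) l) (a (p i) l)) (a-close (p i) (p∈ i) l l≤m))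
        (λ k → near-resp (solve 5 (λ a c s c′ s′ → (c′ :+ s′) :- (c :+ s) := (a :- c) :- ((a :+ s) :- (c′ :+ s′))) refl
          (a (p i) l k) (centre (p i) l k) (drift (p i) k) (centre (p j) l k) (drift (p j) k))
          (centre+drift-near l l≤m j i k))

      b-close-all : ∀ l → l ℕ.≤ m → ∀ i j → normSquared (centre (p j) l ⊝ b (p i) l) ≤ ρ₁
      b-close-all l l≤m i j = perturb {u = centre (p i) l ⊝ b (p i) l} (≤.trans (≤.trans (x≤x+y ρ 0≤σ) ρ₁≤1) 1≤2)
        (proj₂ (b-close (p i) (p∈ i) l l≤m))
        (λ k → near-resp (solve 3 (λ c c′ b → c :- c′ := (c :- b) :- (c′ :- b)) refl
          (centre (p i) l k) (centre (p j) l k) (b (p i) l k)) (centres-near l l≤m i j k))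

      0≤ρ₁ : I → 0# ≤ ρ₁
      0≤ρ₁ i = ≤.trans (normSquared-nonNeg (centre (p i) 0 ⊝ b (p i) 0)) (b-close-all 0 ℕ.z≤n i i)

      θ₀≰ : ¬ (θ₀ ≤ (ρ₂ + ρ₂) + ι d * (ε₁ * ε₁))
      θ₀≰ θ₀≤ = 0<σ (by-gap (gap θ₀≤ ⊕ gap ε₁-small ⊕ 0≤ι d ⊗ 0≤ε₁ ⊗ gap ε₁≤1 ⊕ 0≤ι d ⊗ 0≤ε₁ ⊗ (0<⇒0≤ 0<2 ⊗ 0<⇒0≤ 0<2))
        (solve 4 (λ r s d e → (((r :+ r) :+ d :* (e :* e)) :- (((r :+ r) :+ s) :+ s)) :+ (s :- (d :* (:2 :* :2 :+ :1)) :* e)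
            :+ d :* e :* (:1 :- e) :+ d :* e :* (:2 :* :2) := :0 :- s) refl ρ₂ σ (ι d) ε₁))

      -- The target family `β` is left open: it is the next `b` for an inner step and constantly `t`
      -- for the last one.
      advance : ∀ l → l ℕ.≤ m → I → ∀ (β : I → ℝ^ d) q → (∀ j → normSquared (β j ⊝ q) ≤ ρ₂) →
        (∀ k → Near ε₁ (Eα l k) (E (λ j → β j k))) →
        ∃₂ λ i j → normSquared ((β j ⊝ a (p i) l) ⊝ drift (p i)) ≤ θ l
      advance l l≤m i₀ β q β-close balance =
        let i , j , step = close-pair (λ i k → a (p i) l k + drift (p i) k) β
              (λ k → centre (p i₀) l k + drift (p i₀) k) q (λ i → α-close l l≤m i i₀) β-close balance θ₀≰
        in i , j , ≤.trans (≤.≤-respˡ-≈ (sum-cong-≋ λ k →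
             solve 3 (λ a b s → (b :- (a :+ s)) :* (b :- (a :+ s)) := ((b :- a) :- s) :* ((b :- a) :- s)) refl
               (a (p i) l k) (β j k) (drift (p i) k)) step) (θ₀≤θ l)

      Reach-perturb : ∀ {θ} → θ ≤ 2# → ∀ l i j {q} → Reach l θ (drift (p i)) q → Reach l (θ + σ) (drift (p j)) q
      Reach-perturb θ≤2 l i j = Reach-map (λ q q′ step → perturb {u = (q ⊝ q′) ⊝ drift (p i)} θ≤2 step
        (λ k → near-resp (solve 3 (λ q s s′ → s′ :- s := (q :- s) :- (q :- s′)) refl
          (q k - q′ k) (drift (p i) k) (drift (p j) k)) (drift-near j i k))) l

      -- All samples are treated at once because `advance` gives no control over the pair `i′`, `j`
      -- that it finds. The point `b` of sample `j`, reached with the drift of sample `i′`, is close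
      -- to the centre of every sample `i` and remains reachable with the drift of `i`; so `choose`
      -- cannot have taken its default there.
      reachable : ∀ l → l ℕ.≤ m → ∀ i → Reach l (θ l) (drift (p i)) (a (p i) l)
      reachable zero l≤m i = proj₂ (proj₂ (choose 0 (drift (p i)) 0⃗)) 0⃗ (λ _ → refl)
        (≤.≤-respˡ-≈ (sym (normSquared-self {d} 0⃗)) (0≤ρ₁ i))
      reachable (suc l) l<m i =
        let l≤m = ℕ.<⇒≤ l<m
            i′ , j , step = advance l l≤m i (λ j → b (p j) (suc l)) (centre (p i) (suc l))
              (λ j → ≤.trans (≤.≤-respˡ-≈ (normSquared-flip (centre (p i) (suc l)) (b (p j) (suc l))) (b-close-all (suc l) l<m j i))
                       (x≤x+y ρ₁ 0≤σ))
              (balance-inner l l<m)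
        in proj₂ (proj₂ (choose (suc l) (drift (p i)) (centre (p i) (suc l)))) (b (p j) (suc l))
             (Reach-perturb (θ≤2 l l≤m) (suc l) i′ i
               ((λ _ → proj₁ (b-close (p j) (p∈ j) (suc l) l<m)) , a (p i′) l , reachable l l≤m i′ , step))
             (b-close-all (suc l) l<m j i)

      arrival : I → ∃ λ s → Reach (suc m) 2# s t
      arrival i₀ =
        let i , _ , step = advance m ℕ.≤-refl i₀ (λ _ → t) t
              (λ _ → ≤.≤-respˡ-≈ (sym (normSquared-self t)) (0≤ρ₁ i₀ ⊕ 0≤σ))
              balance-last
        in drift (p i) , Reach-map (λ _ _ ≤θ → ≤.trans ≤θ (θ≤2 m ℕ.≤-refl)) (suc m)
             ((λ 1+m≤m → contradiction 1+m≤m ℕ.1+n≰n) , a (p i) m , reachable m ℕ.≤-refl i , step)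

      -- Over an empty index type, monotonicity would give E 1 ≤ E 0.
      inhabited : I
      inhabited = decidable-stable em λ empty → 0<1
        (≤.≤-respʳ-≈ (E-const 0#) (≤.≤-respˡ-≈ (E-const 1#) (E-mono (λ i → contradiction i empty))))

    walk : ∃ λ s → Reach (suc m) 2# s t
    walk = let I , μ , p , p∈ , near , zero-average = zero-defect in
      arrival μ p p∈ near zero-average (inhabited μ p p∈ near zero-average)

  -- Choice of the constants and conclusion.

  dense-walk : ∀ {d} m (t : ℝ^ d) (X : Subset d) → OneDense X → ∃ λ s → Paths.Reach m X (suc m) 2# s t
  dense-walk {d} m t X dense =
    let γ , 0<γ , uniform = uniformly-dense X dense {ι m * (S + S)} (0≤ι m ⊗ (0≤S ⊕ 0≤S))
        σ , 0<σ , _ , σ-small = small (0≤ι m ⊕ (0≤5 ⊕ 0≤1)) 0<γ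
        ε₁ , 0<ε₁ , ε₁≤1 , ε₁-small = small (0≤ι d ⊗ 0≤5) 0<σ
        ε , 0<ε , ε≤1 , ε-small = small ((0≤ι m ⊕ 0≤ι m) ⊕ (0≤1 ⊕ 0≤1)) 0<ε₁
    in Ensemble.walk m t X {γ = γ} 0≤T t∈ refl (λ y → proj₁ (pick γ uniform y)) (λ y → proj₂ (pick γ uniform y))
         0<σ σ-small 0<ε₁ ε₁≤1 ε₁-small 0<ε ε≤1 ε-small
    where
    -- This gives ‖t‖² ≤ T², which bounds every coordinate of `t` by `T`.
    T = normSquared t + 1#
    0≤T : 0# ≤ T
    0≤T = normSquared-nonNeg t ⊕ 0≤1
    t∈ : InBox T t
    t∈ = normSquared-coordinate {u = t} (0<-mono 0<1 (by-gap (normSquared-nonNeg t)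
        (solve 1 (λ q → q := (q :+ :1) :- :1) refl (normSquared t))))
      (by-gap (square-nonNeg (normSquared t) ⊕ normSquared-nonNeg t ⊕ 0≤1)
        (solve 1 (λ q → q :* q :+ q :+ :1 := (q :+ :1) :* (q :+ :1) :- q) refl (normSquared t)))
    S = (T + ι m) + (2# + 1#)
    0≤S : 0# ≤ S
    0≤S = (0≤T ⊕ 0≤ι m) ⊕ ((0≤1 ⊕ 0≤1) ⊕ 0≤1)
    Box = InBox {d} (ι m * (S + S))
    pick : ∀ γ → (∀ y → Box y → ∃ λ x → x ∈ˢ X × normSquared (y ⊝ x) ≤ 1# - γ) →
           ∀ y → ∃ λ x → Box y → x ∈ˢ X × normSquared (y ⊝ x) ≤ 1# - γ
    pick γ uniform y with em {P = Box y}
    ... | yes y∈ = proj₁ (uniform y y∈) , λ _ → proj₂ (uniform y y∈)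
    -- An arbitrary default: every centre at which `pick` is evaluated for a point of the search box
    -- lies in `Box`.
    ... | no y∉  = 0⃗ , λ y∈ → contradiction y∈ y∉

  nearly-equal-steps : ∀ {d} m (t : ℝ^ d) (X : Subset d) → OneDense X →
    ∃ λ (p : Vector (ℝ^ d) (suc (suc m))) → ∃ λ (s : ℝ^ d) →
      p zero ≋ 0⃗ × p (fromℕ (suc m)) ≋ t ×
      ((i : Fin (suc (suc m))) → 1 ℕ.≤ toℕ i → toℕ i ℕ.≤ m → p i ∈ˢ X) ×
      ((i : Fin (suc m)) → ‖ (p (suc i) ⊝ p (inject₁ i)) ⊝ s ‖ ≤ √2)
  nearly-equal-steps {d} m t X dense = finish (dense-walk m t X dense)
    where
    open Paths m X
    finish : (∃ λ s → Reach (suc m) 2# s t) → _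
    finish (s , r) = (λ i → P (toℕ i)) , s , points-first (suc m) r
      , (λ k → reflexive (≡.cong (λ q → q k) (≡.trans (≡.cong P (toℕ-fromℕ (suc m))) (points-last (suc m) r))))
      , (λ i 1≤i i≤m → points-∈ (suc m) r (toℕ i) 1≤i (ℕ.m≤n⇒m≤1+n i≤m) i≤m)
      , (λ i → norm≤√2 ((P (suc (toℕ i)) ⊝ P (toℕ (inject₁ i))) ⊝ s)
          (≡.subst (λ j → normSquared ((P (suc (toℕ i)) ⊝ P j) ⊝ s) ≤ 2#) (≡.sym (toℕ-inject₁ i))
            (points-step (suc m) r (toℕ i) (toℕ<n i))))
      where
      P : ℕ → ℝ^ d
      P = points (suc m) r

theorem2 :
  ExcludedMiddle 0ℓ →
  (R : CompleteOrderedField) →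
  let open CompleteOrderedField R using (_≤_)
      open Euclidean R
  in
  (d n : ℕ) → .{{_ : NonZero d}} → .{{_ : NonZero n}} →
  (t : ℝ^ d) →
  (X : Subset d) → OneDense X →
  ∃ λ (p : Vector (ℝ^ d) (suc n)) → ∃ λ (s : ℝ^ d) →
    p zero ≋ 0⃗ ×
    p (fromℕ n) ≋ t ×
    ((i : Fin (suc n)) → 1 ℕ.≤ toℕ i → toℕ i ℕ.≤ n ∸ 1 → p i ∈ˢ X) ×
    ((i : Fin n) → ‖ (p (suc i) ⊝ p (inject₁ i)) ⊝ s ‖ ≤ √2)
theorem2 em R d zero    {{_}} {{nz}} t X dense = ⊥-elim-irr (ℕ.NonZero.nonZero nz)
theorem2 em R d (suc m) t X dense = Analysis.nearly-equal-steps em R m t X dense
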